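{- Let $n\ge1$. If $H$ is dense in $\widehat{\mathcal F_n}$, then $\mathrm{Aut}(H)\leqslant\mathrm{Sym}(n)$, i.e. $\mathrm{Aut}(H)$ is isomorphic to a subgroup of the symmetric group $\mathrm{Sym}(n)$. If $H$ is in addition setwise invariant under $\mathrm{Aut}(\widehat{\mathcal F_n})$, as for example $\widehat{\mathcal F_n}$ and $\breve{\mathcal F}_n$ are, then $\mathrm{Aut}(H)=\mathrm{Sym}(n)$ (up to isomorphism).
   Context: Fix $n\ge1$ and symbols $P_1,\dots,P_n$. The partially ordered set $(K_n,\le)$ with valuation map $\mathrm{val}:K_n\to\mathfrak P(\{P_1,\dots,P_n\})$ is the increasing union of finite sets $K_n^d$ ($d\ge 0$) built recursively: $K_n^{ -1}=\emptyset$, and $K_n^d\setminus K_n^{d-1}$ consists of exactly one point $w_{\beta,Y}$ for each pair $(\beta,Y)$ such that (i) $Y$ is a decreasing subset of $K_n^{d-1}$ with $Y\not\subseteq K_n^{d-2}$ (for $d=0$ this last condition is void, so $Y=\emptyset$); (ii) $\beta\subseteq\{P_1,\dots,P_n\}$ and $\beta\subseteq\mathrm{val}(w')$ for all $w'\in Y$; (iii) if $Y$ is the decreasing set generated by a single element $w_{\beta',Y'}$, then $\beta\ne\beta'$. One sets $\mathrm{val}(w_{\beta,Y})=\beta$, and $w\le w_{\beta,Y}$ iff $w\in Y$ or $w=w_{\beta,Y}$. $\widehat{\mathcal F_n}:=\mathcal O_\downarrow(K_n,\le)$ is the Heyting algebra of all decreasing subsets of $K_n$ ($\sqcap=\cap$,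 $\sqcup=\cup$, $a\to b$ = the largest decreasing set contained in $(K_n\setminus a)\cup b$). It carries the metric $\mathrm d(a,b)=2^{ -\min\{i\in\mathbb N\mid a\cap K_n^i\neq b\cap K_n^i\}}$ ($2^{ -\min\emptyset}=0$). "$H$ is dense in $\widehat{\mathcal F_n}$" means that $H$ is a Heyting sub-algebra of $\widehat{\mathcal F_n}$ that is dense for this metric. By a theorem of Bellissima, the Heyting sub-algebra $\mathcal F_n$ of $\widehat{\mathcal F_n}$ generated by $g_i=\{w\in K_n: P_i\in\mathrm{val}(w)\}$, $i=1,\dots,n$, is free on $g_1,\dots,g_n$, and it contains all finite decreasing subsets of $K_n$. $\breve{\mathcal F}_n$ denotes the Heyting sub-algebra of $\mathcal F_n$ generated by the principal sets $\{v\in K_n: v\le w\}$, $w\in K_n$ (these are exactly the completely join-irreducible elements of $\mathcal F_n$); equivalently, generated by all finite decreasing subsets of $K_n$. $\mathrm{Aut}$ denotes the group of Heyting algebra automorphisms. -}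

module Defs where

open import Level using (Level; 0ℓ; _⊔_) renaming (suc to lsuc)
open import Algebra.Bundles using (Group)
open import Algebra.Morphism.Structures using (IsGroupIsomorphism)
open import Data.Empty using (⊥; ⊥-elim)
open import Data.Fin.Base using (Fin)
open import Data.Fin.Permutation using (Permutation′; _⟨$⟩ʳ_; _⟨$⟩ˡ_; _∘ₚ_; flip; inverseˡ; inverseʳ)
  renaming (id to idₚ; _≈_ to _≈ₚ_)
open import Data.Fin.Subset using (Subset) renaming (_⊆_ to _⊆ˢ_)
open import Data.Integer.Base using (+_)
open import Data.List.Base using (List; []; _∷_)
open import Data.List.Relation.Unary.All as All using (All; []; _∷_)
open import Data.List.Relation.Unary.Any as Any using (Any; here; there)
open import Data.Nat.Base as ℕ using (ℕ; zero; suc)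
open import Data.Nat.Properties using (m^n≢0)
open import Data.Product.Base using (Σ; ∃; _×_; _,_; proj₁; proj₂)
open import Data.Rational.Base as ℚ using (ℚ; 0ℚ; _/_)
open import Data.Sum.Base using (_⊎_; inj₁; inj₂; [_,_])
open import Data.Unit.Base using (⊤; tt)
open import Function.Bundles using (Inverse; _⇔_; mk⇔; module Equivalence)
open import Function.Construct.Composition using () renaming (inverse to comp-inverse)
open import Function.Construct.Identity using () renaming (inverse to id-inverse)
open import Function.Construct.Symmetry using () renaming (inverse to sym-inverse)
open import Induction.WellFounded using (Acc; acc; WellFounded; wf⇒asym)
open import Relation.Binary.Bundles using (Poset; Setoid)
open import Relation.Binary.Lattice.Bundles using (HeytingAlgebra)
open import Relation.Binary.PropositionalEquality.Core using (_≡_; _≢_; refl; sym; trans; cong)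
open import Relation.Nullary.Negation.Core using (¬_)
open import Relation.Unary using (Pred)

------------------------------------------------------------------------
-- Groups

record Subgroup {c ℓ} (G : Group c ℓ) s : Set (c ⊔ ℓ ⊔ lsuc s) where
  open Group G
  field
    member : Pred Carrier s
    resp   : ∀ {x y} → x ≈ y → member x → member y
    ∙-mem  : ∀ {x y} → member x → member y → member (x ∙ y)
    ε-mem  : member ε
    ⁻¹-mem : ∀ {x} → member x → member (x ⁻¹)

  group : Group (c ⊔ s) ℓ
  group = record
    { Carrier = Σ Carrier member
    ; _≈_     = λ x y → proj₁ x ≈ proj₁ y
    ; _∙_     = λ x y → proj₁ x ∙ proj₁ y , ∙-mem (proj₂ x) (proj₂ y)
    ; ε       = ε , ε-mem
    ; _⁻¹     = λ x → proj₁ x ⁻¹ , ⁻¹-mem (proj₂ x)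
    ; isGroup = record
      { isMonoid = record
        { isSemigroup = record
          { isMagma = record
            { isEquivalence = record
              { refl = Group.refl G ; sym = Group.sym G ; trans = Group.trans G }
            ; ∙-cong = ∙-cong
            }
          ; assoc = λ x y z → assoc (proj₁ x) (proj₁ y) (proj₁ z)
          }
        ; identity = (λ x → identityˡ (proj₁ x)) , (λ x → identityʳ (proj₁ x))
        }
      ; inverse = (λ x → inverseˡ′ (proj₁ x)) , (λ x → inverseʳ′ (proj₁ x))
      ; ⁻¹-cong = ⁻¹-cong
      }
    }
    where
      inverseˡ′ = Group.inverseˡ G
      inverseʳ′ = Group.inverseʳ G

infix 4 _≅_

_≅_ : ∀ {c₁ ℓ₁ c₂ ℓ₂} → Group c₁ ℓ₁ → Group c₂ ℓ₂ → Set (c₁ ⊔ ℓ₁ ⊔ c₂ ⊔ ℓ₂)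
G ≅ G′ = ∃ λ f → IsGroupIsomorphism (Group.rawGroup G) (Group.rawGroup G′) f

-- The product π ∙ ρ is "first ρ, then π"; _∘ₚ_ composes diagrammatically.
Sym : ℕ → Group 0ℓ 0ℓ
Sym n = record
  { Carrier = Permutation′ n
  ; _≈_     = _≈ₚ_
  ; _∙_     = λ π ρ → ρ ∘ₚ π
  ; ε       = idₚ
  ; _⁻¹     = flip
  ; isGroup = record
    { isMonoid = record
      { isSemigroup = record
        { isMagma = record
          { isEquivalence = record
            { refl  = λ _ → refl
            ; sym   = λ p i → sym (p i)
            ; trans = λ p q i → trans (p i) (q i)
            }
          ; ∙-cong = λ {π} {π′} {ρ} {ρ′} p q i →
              trans (cong (π ⟨$⟩ʳ_) (q i)) (p (ρ′ ⟨$⟩ʳ i))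
          }
        ; assoc = λ _ _ _ _ → refl
        }
      ; identity = (λ _ _ → refl) , (λ _ _ → refl)
      }
    ; inverse = (λ π _ → inverseˡ π) , (λ π _ → inverseʳ π)
    ; ⁻¹-cong = λ {π} {ρ} p i →
        trans (sym (cong (π ⟨$⟩ˡ_) (trans (p (ρ ⟨$⟩ˡ i)) (inverseʳ ρ))))
              (inverseˡ π)
    }
  }

------------------------------------------------------------------------
-- Heyting algebras: automorphisms and subalgebras

module _ {c ℓ₁ ℓ₂} (A : HeytingAlgebra c ℓ₁ ℓ₂) where
  open HeytingAlgebra A hiding (refl; trans; reflexive)
    renaming (⊤ to ⊤ᴬ; ⊥ to ⊥ᴬ)

  carrierSetoid : Setoid c ℓ₁
  carrierSetoid = record { isEquivalence = isEquivalence }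

  record Automorphism : Set (c ⊔ ℓ₁) where
    field
      bijection : Inverse carrierSetoid carrierSetoid

    open Inverse bijection public

    field
      ∧-homo : ∀ x y → to (x ∧ y) ≈ to x ∧ to y
      ∨-homo : ∀ x y → to (x ∨ y) ≈ to x ∨ to y
      ⇨-homo : ∀ x y → to (x ⇨ y) ≈ (to x ⇨ to y)
      ⊤-homo : to ⊤ᴬ ≈ ⊤ᴬ
      ⊥-homo : to ⊥ᴬ ≈ ⊥ᴬ

  private
    ∧-congᴬ : ∀ {x x′ y y′} → x ≈ x′ → y ≈ y′ → x ∧ y ≈ x′ ∧ y′
    ∧-congᴬ p q = antisym (mono p q) (mono (Eq.sym p) (Eq.sym q))
      where
        mono : ∀ {x x′ y y′} → x ≈ x′ → y ≈ y′ → x ∧ y ≤ x′ ∧ y′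
        mono {x} {x′} {y} {y′} p q = ∧-greatest
          (HeytingAlgebra.trans A (x∧y≤x x y) (HeytingAlgebra.reflexive A p))
          (HeytingAlgebra.trans A (x∧y≤y x y) (HeytingAlgebra.reflexive A q))

    ∨-congᴬ : ∀ {x x′ y y′} → x ≈ x′ → y ≈ y′ → x ∨ y ≈ x′ ∨ y′
    ∨-congᴬ p q = antisym (mono p q) (mono (Eq.sym p) (Eq.sym q))
      where
        mono : ∀ {x x′ y y′} → x ≈ x′ → y ≈ y′ → x ∨ y ≤ x′ ∨ y′
        mono {x} {x′} {y} {y′} p q = ∨-least
          (HeytingAlgebra.trans A (HeytingAlgebra.reflexive A p) (x≤x∨y x′ y′))
          (HeytingAlgebra.trans A (HeytingAlgebra.reflexive A q) (y≤x∨y x′ y′))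

    ⇨-congᴬ : ∀ {x x′ y y′} → x ≈ x′ → y ≈ y′ → (x ⇨ y) ≈ (x′ ⇨ y′)
    ⇨-congᴬ p q = antisym (mono p q) (mono (Eq.sym p) (Eq.sym q))
      where
        mono : ∀ {x x′ y y′} → x ≈ x′ → y ≈ y′ → (x ⇨ y) ≤ (x′ ⇨ y′)
        mono {x} {x′} {y} {y′} p q = transpose-⇨
          (HeytingAlgebra.trans A
            (HeytingAlgebra.reflexive A (∧-congᴬ Eq.refl (Eq.sym p)))
            (HeytingAlgebra.trans A (transpose-∧ (HeytingAlgebra.refl A))
              (HeytingAlgebra.reflexive A q)))

    idᴬ : Automorphism
    idᴬ = record
      { bijection = id-inverse carrierSetoid
      ; ∧-homo = λ _ _ → Eq.refl
      ; ∨-homo = λ _ _ → Eq.refl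
      ; ⇨-homo = λ _ _ → Eq.refl
      ; ⊤-homo = Eq.refl
      ; ⊥-homo = Eq.refl
      }

    compᴬ : Automorphism → Automorphism → Automorphism
    compᴬ φ ψ = record
      { bijection = comp-inverse ψ.bijection φ.bijection
      ; ∧-homo = λ x y → Eq.trans (φ.to-cong (ψ.∧-homo x y)) (φ.∧-homo _ _)
      ; ∨-homo = λ x y → Eq.trans (φ.to-cong (ψ.∨-homo x y)) (φ.∨-homo _ _)
      ; ⇨-homo = λ x y → Eq.trans (φ.to-cong (ψ.⇨-homo x y)) (φ.⇨-homo _ _)
      ; ⊤-homo = Eq.trans (φ.to-cong ψ.⊤-homo) φ.⊤-homo
      ; ⊥-homo = Eq.trans (φ.to-cong ψ.⊥-homo) φ.⊥-homo
      }
      where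
        module φ = Automorphism φ
        module ψ = Automorphism ψ

    invᴬ : Automorphism → Automorphism
    invᴬ φ = record
      { bijection = sym-inverse φ.bijection
      ; ∧-homo = λ x y → φ.inverseʳ (Eq.sym (Eq.trans (φ.∧-homo _ _)
          (∧-congᴬ (φ.strictlyInverseˡ x) (φ.strictlyInverseˡ y))))
      ; ∨-homo = λ x y → φ.inverseʳ (Eq.sym (Eq.trans (φ.∨-homo _ _)
          (∨-congᴬ (φ.strictlyInverseˡ x) (φ.strictlyInverseˡ y))))
      ; ⇨-homo = λ x y → φ.inverseʳ (Eq.sym (Eq.trans (φ.⇨-homo _ _)
          (⇨-congᴬ (φ.strictlyInverseˡ x) (φ.strictlyInverseˡ y))))
      ; ⊤-homo = φ.inverseʳ (Eq.sym φ.⊤-homo)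
      ; ⊥-homo = φ.inverseʳ (Eq.sym φ.⊥-homo)
      }
      where module φ = Automorphism φ

  open Automorphism using (to; from; to-cong; from-cong; strictlyInverseˡ; strictlyInverseʳ)

  Aut : Group (c ⊔ ℓ₁) (c ⊔ ℓ₁)
  Aut = record
    { Carrier = Automorphism
    ; _≈_     = λ φ ψ → ∀ x → to φ x ≈ to ψ x
    ; _∙_     = compᴬ
    ; ε       = idᴬ
    ; _⁻¹     = invᴬ
    ; isGroup = record
      { isMonoid = record
        { isSemigroup = record
          { isMagma = record
            { isEquivalence = record
              { refl  = λ _ → Eq.refl
              ; sym   = λ p x → Eq.sym (p x)
              ; trans = λ p q x → Eq.trans (p x) (q x)
              }
            ; ∙-cong = λ {φ} {φ′} {ψ} {ψ′} p q x →
                Eq.trans (to-cong φ (q x)) (p (to ψ′ x))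
            }
          ; assoc = λ _ _ _ _ → Eq.refl
          }
        ; identity = (λ _ _ → Eq.refl) , (λ _ _ → Eq.refl)
        }
      ; inverse = (λ φ x → strictlyInverseʳ φ x) , (λ φ x → strictlyInverseˡ φ x)
      ; ⁻¹-cong = λ {φ} {ψ} p x → Eq.trans
          (Eq.sym (from-cong φ (Eq.trans (p (from ψ x)) (strictlyInverseˡ ψ x))))
          (strictlyInverseʳ φ (from ψ x))
      }
    }

  record Subalgebra s : Set (c ⊔ ℓ₁ ⊔ lsuc s) where
    field
      member : Pred Carrier s
      resp   : ∀ {x y} → x ≈ y → member x → member y
      ∧-mem  : ∀ {x y} → member x → member y → member (x ∧ y)
      ∨-mem  : ∀ {x y} → member x → member y → member (x ∨ y)
      ⇨-mem  : ∀ {x y} → member x → member y → member (x ⇨ y)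
      ⊤-mem  : member ⊤ᴬ
      ⊥-mem  : member ⊥ᴬ

    algebra : HeytingAlgebra (c ⊔ s) ℓ₁ ℓ₂
    algebra = record
      { Carrier = Σ Carrier member
      ; _≈_     = λ x y → proj₁ x ≈ proj₁ y
      ; _≤_     = λ x y → proj₁ x ≤ proj₁ y
      ; _∨_     = λ x y → proj₁ x ∨ proj₁ y , ∨-mem (proj₂ x) (proj₂ y)
      ; _∧_     = λ x y → proj₁ x ∧ proj₁ y , ∧-mem (proj₂ x) (proj₂ y)
      ; _⇨_     = λ x y → (proj₁ x ⇨ proj₁ y) , ⇨-mem (proj₂ x) (proj₂ y)
      ; ⊤       = ⊤ᴬ , ⊤-mem
      ; ⊥       = ⊥ᴬ , ⊥-mem
      ; isHeytingAlgebra = record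
        { isBoundedLattice = record
          { isLattice = record
            { isPartialOrder = record
              { isPreorder = record
                { isEquivalence = record
                  { refl = Eq.refl ; sym = Eq.sym ; trans = Eq.trans }
                ; reflexive = HeytingAlgebra.reflexive A
                ; trans     = HeytingAlgebra.trans A
                }
              ; antisym = antisym
              }
            ; supremum = λ x y → x≤x∨y _ _ , y≤x∨y _ _ , λ z → ∨-least
            ; infimum  = λ x y → x∧y≤x _ _ , x∧y≤y _ _ , λ z → ∧-greatest
            }
          ; maximum = λ x → maximum (proj₁ x)
          ; minimum = λ x → minimum (proj₁ x)
          }
        ; exponential = λ w x y → exponential (proj₁ w) (proj₁ x) (proj₁ y)
        }
      }

  whole : Subalgebra 0ℓ
  whole = record
    { member = λ _ → ⊤
    ; resp   = λ _ _ → tt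
    ; ∧-mem  = λ _ _ → tt
    ; ∨-mem  = λ _ _ → tt
    ; ⇨-mem  = λ _ _ → tt
    ; ⊤-mem  = tt
    ; ⊥-mem  = tt
    }

  data Generated {x} (X : Pred Carrier x) : Pred Carrier (c ⊔ ℓ₁ ⊔ x) where
    gen   : ∀ {a} → X a → Generated X a
    resp  : ∀ {a b} → a ≈ b → Generated X a → Generated X b
    ∧-mem : ∀ {a b} → Generated X a → Generated X b → Generated X (a ∧ b)
    ∨-mem : ∀ {a b} → Generated X a → Generated X b → Generated X (a ∨ b)
    ⇨-mem : ∀ {a b} → Generated X a → Generated X b → Generated X (a ⇨ b)
    ⊤-mem : Generated X ⊤ᴬ
    ⊥-mem : Generated X ⊥ᴬ

  generated : ∀ {x} → Pred Carrier x → Subalgebra (c ⊔ ℓ₁ ⊔ x)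
  generated X = record
    { member = Generated X
    ; resp   = resp
    ; ∧-mem  = ∧-mem
    ; ∨-mem  = ∨-mem
    ; ⇨-mem  = ⇨-mem
    ; ⊤-mem  = ⊤-mem
    ; ⊥-mem  = ⊥-mem
    }

  -- φ[H] = H for every automorphism φ of A.
  Invariant : ∀ {s} → Subalgebra s → Set (c ⊔ ℓ₁ ⊔ s)
  Invariant H = ∀ (φ : Automorphism) →
      (∀ {a} → member a → member (to φ a))
    × (∀ {b} → member b → ∃ λ a → member a × to φ a ≈ b)
    where open Subalgebra H

------------------------------------------------------------------------
-- The Heyting algebra of decreasing subsets of a poset

module _ (P : Poset 0ℓ 0ℓ 0ℓ) where
  private
    module P = Poset P

  -- As P._≤_ is reflexive with respect to P._≈_, a decreasing subset respects
  -- P._≈_.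
  record DownSet : Set₁ where
    field
      member     : Pred P.Carrier 0ℓ
      decreasing : ∀ {v w} → v P.≤ w → member w → member v

  open DownSet

  principal : P.Carrier → DownSet
  principal w = record { member = P._≤ w ; decreasing = P.trans }

  -- The implication is the largest decreasing subset of (P ∖ a) ∪ b, that
  -- is, the set of the w such that every v ≤ w lies in (P ∖ a) ∪ b.
  𝓞↓ : HeytingAlgebra (lsuc 0ℓ) 0ℓ 0ℓ
  𝓞↓ = record
    { Carrier = DownSet
    ; _≈_ = λ a b → ∀ w → member a w ⇔ member b w
    ; _≤_ = λ a b → ∀ w → member a w → member b w
    ; _∨_ = λ a b → record
        { member     = λ w → member a w ⊎ member b w
        ; decreasing = λ v≤w → [ (λ p → inj₁ (decreasing a v≤w p))
                               , (λ p → inj₂ (decreasing b v≤w p)) ] }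
    ; _∧_ = λ a b → record
        { member     = λ w → member a w × member b w
        ; decreasing = λ v≤w p → decreasing a v≤w (proj₁ p) , decreasing b v≤w (proj₂ p) }
    ; _⇨_ = λ a b → record
        { member     = λ w → ∀ v → v P.≤ w → member a v → member b v
        ; decreasing = λ v≤w p u u≤v → p u (P.trans u≤v v≤w) }
    ; ⊤ = record { member = λ _ → ⊤ ; decreasing = λ _ _ → tt }
    ; ⊥ = record { member = λ _ → ⊥ ; decreasing = λ _ p → p }
    ; isHeytingAlgebra = record
      { isBoundedLattice = record
        { isLattice = record
          { isPartialOrder = record
            { isPreorder = record
              { isEquivalence = record
                { refl  = λ w → mk⇔ (λ p → p) (λ p → p)
                ; sym   = λ e w → mk⇔ (from (e w)) (to (e w))
                ; trans = λ e f w → mk⇔ (λ p → to (f w) (to (e w) p))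
                                        (λ p → from (e w) (from (f w) p))
                }
              ; reflexive = λ e w → to (e w)
              ; trans     = λ f g w p → g w (f w p)
              }
            ; antisym = λ f g w → mk⇔ (f w) (g w)
            }
          ; supremum = λ a b → (λ w → inj₁) , (λ w → inj₂) , λ c f g w → [ f w , g w ]
          ; infimum  = λ a b → (λ w → proj₁) , (λ w → proj₂) , λ c f g w p → f w p , g w p
          }
        ; maximum = λ a w _ → tt
        ; minimum = λ a w ()
        }
      ; exponential = λ c a b →
            (λ f w p v v≤w q → f v (decreasing c v≤w p , q))
          , (λ f w p → f w (proj₁ p) w P.refl (proj₂ p))
      }
    }
    where open Equivalence using (to; from)

------------------------------------------------------------------------
-- The poset K_n

-- Formal symbols w_{β,Y}.  Every K_n^d is finite, so its subsets Y can be
-- given by lists; two lists are the same set when they have the same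
-- elements, and _≈ʷ_ is the resulting hereditary equality of symbols.
data W (n : ℕ) : Set where
  node : (β : Subset n) (Y : List (W n)) → W n

module _ {n : ℕ} where

  infix 4 _≈ʷ_ _∈ʷ_ _≤ʷ_

  val : W n → Subset n
  val (node β _) = β

  below : W n → List (W n)
  below (node _ Y) = Y

  data _≈ʷ_ : W n → W n → Set where
    node : ∀ {β γ Y Z} → β ≡ γ →
           All (λ y → Any (λ z → y ≈ʷ z) Z) Y →
           All (λ z → Any (λ y → y ≈ʷ z) Y) Z →
           node β Y ≈ʷ node γ Z

  _∈ʷ_ : W n → List (W n) → Set
  v ∈ʷ Y = Any (λ y → v ≈ʷ y) Y

  _≤ʷ_ : W n → W n → Set
  v ≤ʷ w = v ∈ʷ below w ⊎ v ≈ʷ w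

  mutual
    -- Stage d is K_n^{d-1}; thus Stage 0 = K_n^{-1} = ∅.
    Stage : ℕ → Pred (W n) 0ℓ
    Stage zero    _ = ⊥
    Stage (suc d) w = Stage d w ⊎ New d w

    -- New d is K_n^d ∖ K_n^{d-1}.
    New : ℕ → Pred (W n) 0ℓ
    New d (node β Y) =
        All (Stage d) Y
      × (∀ {v w′} → Stage d v → w′ ∈ʷ Y → v ≤ʷ w′ → v ∈ʷ Y)
      × Fresh d Y
      × (∀ {w′} → w′ ∈ʷ Y → β ⊆ˢ val w′)
      × (∀ {w′} → Stage d w′ → (∀ {v} → Stage d v → v ∈ʷ Y ⇔ v ≤ʷ w′) → β ≢ val w′)

    -- Y ⊄ K_n^{d-2}; no condition for d = 0.
    Fresh : ℕ → List (W n) → Set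
    Fresh zero    _ = ⊤
    Fresh (suc d) Y = ¬ All (Stage d) Y

  private
    mutual
      ≈-refl : ∀ {w} → w ≈ʷ w
      ≈-refl {node β Y} = node refl (reflˡ Y (λ p → p)) (reflʳ Y (λ p → p))

      reflˡ : ∀ Y {Z} → (∀ {P : Pred (W n) 0ℓ} → Any P Y → Any P Z) →
              All (λ y → Any (λ z → y ≈ʷ z) Z) Y
      reflˡ []      f = []
      reflˡ (y ∷ Y) f = f (here (≈-refl {y})) ∷ reflˡ Y (λ p → f (there p))

      reflʳ : ∀ Y {Z} → (∀ {P : Pred (W n) 0ℓ} → Any P Y → Any P Z) →
              All (λ y → Any (λ z → z ≈ʷ y) Z) Y
      reflʳ []      f = []
      reflʳ (y ∷ Y) f = f (here (≈-refl {y})) ∷ reflʳ Y (λ p → f (there p))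

    mutual
      ≈-sym : ∀ {v w} → v ≈ʷ w → w ≈ʷ v
      ≈-sym (node e p q) = node (sym e) (symˡ q) (symʳ p)

      symˡ : ∀ {Y Z} → All (λ z → Any (λ y → y ≈ʷ z) Y) Z → All (λ z → Any (λ y → z ≈ʷ y) Y) Z
      symˡ []       = []
      symˡ (p ∷ ps) = symˡ′ p ∷ symˡ ps

      symˡ′ : ∀ {z Y} → Any (λ y → y ≈ʷ z) Y → Any (λ y → z ≈ʷ y) Y
      symˡ′ (here p)  = here (≈-sym p)
      symˡ′ (there p) = there (symˡ′ p)

      symʳ : ∀ {Y Z} → All (λ z → Any (λ y → z ≈ʷ y) Y) Z → All (λ z → Any (λ y → y ≈ʷ z) Y) Z
      symʳ []       = []
      symʳ (p ∷ ps) = symʳ′ p ∷ symʳ ps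

      symʳ′ : ∀ {z Y} → Any (λ y → z ≈ʷ y) Y → Any (λ y → y ≈ʷ z) Y
      symʳ′ (here p)  = here (≈-sym p)
      symʳ′ (there p) = there (symʳ′ p)

    mutual
      ≈-trans : ∀ {u v w} → u ≈ʷ v → v ≈ʷ w → u ≈ʷ w
      ≈-trans (node e p q) (node e′ p′ q′) = node (trans e e′) (transˡ p p′) (transʳ q′ q)

      transˡ : ∀ {X Y Z} → All (λ x → Any (λ y → x ≈ʷ y) Y) X →
               All (λ y → Any (λ z → y ≈ʷ z) Z) Y → All (λ x → Any (λ z → x ≈ʷ z) Z) X
      transˡ []       q = []
      transˡ (p ∷ ps) q = transˡ′ p q ∷ transˡ ps q

      transˡ′ : ∀ {x Y Z} → Any (λ y → x ≈ʷ y) Y →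
                All (λ y → Any (λ z → y ≈ʷ z) Z) Y → Any (λ z → x ≈ʷ z) Z
      transˡ′ (here p)  (q ∷ _)  = transˡ″ p q
      transˡ′ (there p) (_ ∷ qs) = transˡ′ p qs

      transˡ″ : ∀ {x y Z} → x ≈ʷ y → Any (λ z → y ≈ʷ z) Z → Any (λ z → x ≈ʷ z) Z
      transˡ″ p (here q)  = here (≈-trans p q)
      transˡ″ p (there q) = there (transˡ″ p q)

      transʳ : ∀ {X Y Z} → All (λ z → Any (λ y → y ≈ʷ z) Y) Z →
               All (λ y → Any (λ x → x ≈ʷ y) X) Y → All (λ z → Any (λ x → x ≈ʷ z) X) Z
      transʳ []       q = []
      transʳ (p ∷ ps) q = transʳ′ p q ∷ transʳ ps q

      transʳ′ : ∀ {z X Y} → Any (λ y → y ≈ʷ z) Y →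
                All (λ y → Any (λ x → x ≈ʷ y) X) Y → Any (λ x → x ≈ʷ z) X
      transʳ′ (here p)  (q ∷ _)  = transʳ″ p q
      transʳ′ (there p) (_ ∷ qs) = transʳ′ p qs

      transʳ″ : ∀ {y z X} → y ≈ʷ z → Any (λ x → x ≈ʷ y) X → Any (λ x → x ≈ʷ z) X
      transʳ″ p (here q)  = here (≈-trans q p)
      transʳ″ p (there q) = there (transʳ″ p q)

    ∈-respˡ : ∀ {u v Y} → u ≈ʷ v → v ∈ʷ Y → u ∈ʷ Y
    ∈-respˡ e = Any.map (≈-trans e)

    ∈-below : ∀ {u v w} → v ≈ʷ w → u ∈ʷ below v → u ∈ʷ below w
    ∈-below (node _ p _) m = transˡ′ m p

    ≤-resp : ∀ {u v w} → v ≈ʷ w → u ≤ʷ v → u ≤ʷ w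
    ≤-resp e (inj₁ m) = inj₁ (∈-below e m)
    ≤-resp e (inj₂ f) = inj₂ (≈-trans f e)

    _◁_ : W n → W n → Set
    v ◁ w = v ∈ʷ below w

    acc-resp : ∀ {v w} → v ≈ʷ w → Acc _◁_ v → Acc _◁_ w
    acc-resp e (acc rs) = acc (λ m → rs (∈-below (≈-sym e) m))

    mutual
      ◁-wf : WellFounded _◁_
      ◁-wf (node β Y) = acc (◁-wf′ Y)

      ◁-wf′ : ∀ Y {v} → v ∈ʷ Y → Acc _◁_ v
      ◁-wf′ (y ∷ Y) (here e)  = acc-resp (≈-sym e) (◁-wf y)
      ◁-wf′ (y ∷ Y) (there m) = ◁-wf′ Y m

    ≤-antisym : ∀ {v w} → v ≤ʷ w → w ≤ʷ v → v ≈ʷ w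
    ≤-antisym (inj₂ e) _        = e
    ≤-antisym (inj₁ _) (inj₂ e) = ≈-sym e
    ≤-antisym (inj₁ p) (inj₁ q) = ⊥-elim (wf⇒asym ◁-wf p q)

    stage-new : ∀ d {w} → Stage d w → ∃ λ e → New e w
    stage-new (suc d) (inj₁ s) = stage-new d s
    stage-new (suc d) (inj₂ s) = d , s

    stage-below : ∀ d {w} → Stage d w → All (Stage d) (below w)
    stage-below (suc d) (inj₁ s) = All.map inj₁ (stage-below d s)
    stage-below (suc d) {node β Y} (inj₂ s) = All.map inj₁ (proj₁ s)

    ∈-stage : ∀ d {v Y} → All (Stage d) Y → v ∈ʷ Y → ∃ λ y → v ≈ʷ y × Stage d y × y ∈ʷ Y
    ∈-stage d (s ∷ _)  (here e)  = _ , e , s , here ≈-refl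
    ∈-stage d (_ ∷ ss) (there m) with ∈-stage d ss m
    ... | y , e , s , m′ = y , e , s , there m′

    below-decreasing : ∀ d {w} → New d w → ∀ {u v} → u ∈ʷ below v → v ∈ʷ below w → u ∈ʷ below w
    below-decreasing d {node β Y} (all , down , _) {u} {v} m k
      with ∈-stage d all k
    ... | v′ , e , s , k′ with ∈-stage d (stage-below d s) (∈-below e m)
    ... | u′ , e′ , s′ , m′ = ∈-respˡ e′ (down s′ k′ (inj₁ m′))

    ≤-trans : ∀ d {w} → Stage d w → ∀ {u v} → u ≤ʷ v → v ≤ʷ w → u ≤ʷ w
    ≤-trans d s p        (inj₂ e) = ≤-resp e p
    ≤-trans d s (inj₂ e) (inj₁ m) = inj₁ (∈-respˡ e m)
    ≤-trans d s (inj₁ k) (inj₁ m) with stage-new d s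
    ... | e , new = inj₁ (below-decreasing e new k m)

  posetK : Poset 0ℓ 0ℓ 0ℓ
  posetK = record
    { Carrier = ∃ λ w → ∃ λ d → Stage d w
    ; _≈_ = λ v w → proj₁ v ≈ʷ proj₁ w
    ; _≤_ = λ v w → proj₁ v ≤ʷ proj₁ w
    ; isPartialOrder = record
      { isPreorder = record
        { isEquivalence = record { refl = ≈-refl ; sym = ≈-sym ; trans = ≈-trans }
        ; reflexive = inj₂
        ; trans = λ {_} {_} {w} p q → ≤-trans (proj₁ (proj₂ w)) (proj₂ (proj₂ w)) p q
        }
      ; antisym = ≤-antisym
      }
    }

K : ℕ → Poset 0ℓ 0ℓ 0ℓ
K n = posetK {n}

------------------------------------------------------------------------
-- The algebra F̂ n of decreasing subsets of K_n, and its subalgebra F̆ n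

F̂ : ℕ → HeytingAlgebra (lsuc 0ℓ) 0ℓ 0ℓ
F̂ n = 𝓞↓ (K n)

-- Generation is taken inside F̂ n.  The result is the same as inside any
-- subalgebra of F̂ n which contains the principal sets, such as the free
-- algebra generated by the sets { w ∣ P_i ∈ val w }.
F̆ : ∀ n → Subalgebra (F̂ n) (lsuc 0ℓ)
F̆ n = generated (F̂ n) (λ a → ∃ λ w → a F̂.≈ principal (K n) w)
  where module F̂ = HeytingAlgebra (F̂ n)

module _ (n : ℕ) where
  open HeytingAlgebra (F̂ n) using (Carrier)

  -- a ∩ K_n^i = b ∩ K_n^i
  AgreeOn : ℕ → Carrier → Carrier → Set
  AgreeOn i a b = ∀ w → Stage (suc i) (proj₁ w) → DownSet.member a w ⇔ DownSet.member b w

  2^-_ : ℕ → ℚ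
  2^- i = (+ 1 / 2 ℕ.^ i) {{m^n≢0 2 i}}

  -- The graph of the metric: Distance a b q means d(a,b) = q, the i of differ
  -- being the least index at which a and b disagree.
  data Distance (a b : Carrier) : ℚ → Set where
    agree  : (∀ i → AgreeOn i a b) → Distance a b 0ℚ
    differ : ∀ i → ¬ AgreeOn i a b → (∀ j → j ℕ.< i → AgreeOn j a b) →
             Distance a b (2^- i)

  Dense : ∀ {s} → Subalgebra (F̂ n) s → Set (lsuc 0ℓ ⊔ s)
  Dense H = ∀ a ε → 0ℚ ℚ.< ε →
    ∃ λ h → Subalgebra.member H h × ∃ λ q → Distance a h q × q ℚ.< ε

{-
An automorphism of a dense H permutes the principal sets ↓w, which lie in H
because H contains every decreasing set confined to some K_n^d: an element of
H agreeing with such a set on K_n^{d+1} meets no layer beyond K_n^d, hence is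
that set.  So automorphisms of H come from order automorphisms of K_n.

The order of K_n almost determines its valuation.  Call u a cover of w and x
when the points strictly below u form ↓w ∪ ↓x; for minimal x they are the w_{δ,↓w∪↓x} with
δ ⊆ val w ∩ val x, with the exception of δ = val w if x ≤ w.  The minimal
points w_{{P_i},∅} are thus the minimal points x with exactly one cover of x
and x, so an order automorphism permutes them, by a permutation π say.  For
x = w_{{P_i},∅}, P_i ∈ val w holds iff w and x have a cover, if x ≤ w, or two
distinct covers, if x ≰ w.  Hence val (f w) = π (val w), and π determines f by
induction on the layers.  Conversely, Sym(n) acts on K_n by permuting the
symbols.
-}
module Submission where

open import Defs
open import Level using (0ℓ; _⊔_) renaming (suc to lsuc)
open import Algebra.Bundles using (Group)
open import Algebra.Morphism.Structures using (IsGroupHomomorphism)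
import Algebra.Properties.Group as GroupProperties
open import Axiom.ExcludedMiddle using (ExcludedMiddle)
open import Data.Bool.Base using (true; false)
open import Data.Fin.Base using (Fin)
open import Data.Fin.Permutation using (Permutation′; permutation; _⟨$⟩ʳ_; _⟨$⟩ˡ_; _∘ₚ_; flip; inverseˡ; inverseʳ) renaming (_≈_ to _≈ₚ_)
open import Data.Fin.Subset as Subset using (Subset; ⁅_⁆) renaming (_∈_ to _∈ˢ_; _∉_ to _∉ˢ_; _⊆_ to _⊆ˢ_; ⊥ to ∅)
open import Data.Fin.Subset.Properties as Subset using ()
open import Data.Integer.Base as ℤ using (+_)
open import Data.Integer.Properties as ℤ using ()
open import Data.List.Base using (List; []; _∷_; _++_; map; filter; foldr; cartesianProductWith)
open import Data.List.Membership.Propositional using (_∈_; find; lose)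
open import Data.List.Membership.Propositional.Properties as List using ()
open import Data.List.Relation.Unary.All as All using (All; []; _∷_)
open import Data.List.Relation.Unary.Any as Any using (Any; here; there)
open import Data.List.Relation.Unary.Any.Properties as Any using ()
open import Data.Nat.Base as ℕ using (ℕ; zero; suc; _≤_)
open import Data.Nat.Properties as ℕ using ()
open import Data.Product.Base using (∃; _×_; _,_; proj₁; proj₂)
open import Data.Rational.Base as ℚ using (ℚ; 0ℚ; mkℚ; *<*)
open import Data.Rational.Properties as ℚ using ()
open import Data.Rational.Unnormalised.Base as ℚᵘ using (mkℚᵘ)
open import Data.Rational.Unnormalised.Properties as ℚᵘ using ()
open import Data.Sum.Base as Sum using (_⊎_; inj₁; inj₂; [_,_])
open import Data.Unit.Base using (tt)
open import Data.Vec.Base using ([]; _∷_; lookup; tabulate)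
open import Data.Vec.Properties as Vec using ()
open import Function.Base using (_∘_; id)
open import Function.Bundles using (_⇔_; mk⇔; module Equivalence)
open import Relation.Binary.Bundles using (Poset)
open import Relation.Binary.Lattice.Bundles using (HeytingAlgebra)
open import Relation.Binary.PropositionalEquality.Core using (_≡_; _≢_; refl; sym; trans; cong; cong₂; subst)
open import Relation.Nullary using (Dec; ¬_; yes; no; contradiction)
open import Relation.Nullary.Decidable using (decidable-stable)
open import Relation.Unary using (Decidable)

open Equivalence using (to; from)

-- Points of K_n

module _ {n : ℕ} where

  mutual
    W-ind : ∀ {p} {P : W n → Set p} → (∀ β Y → All P Y → P (node β Y)) → ∀ w → P w
    W-ind step (node β Y) = step β Y (W-inds step Y)

    W-inds : ∀ {p} {P : W n → Set p} → (∀ β Y → All P Y → P (node β Y)) → ∀ Y → All P Y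
    W-inds step []      = []
    W-inds step (y ∷ Y) = W-ind step y ∷ W-inds step Y

  ≈-refl : ∀ {w : W n} → w ≈ʷ w
  ≈-refl = W-ind (λ β Y ih → node refl
    (All.tabulate (λ y∈Y → lose y∈Y (All.lookup ih y∈Y)))
    (All.tabulate (λ y∈Y → lose y∈Y (All.lookup ih y∈Y)))) _

  ≈-sym : ∀ {v w : W n} → v ≈ʷ w → w ≈ʷ v
  ≈-sym = W-ind {P = λ v → ∀ {w} → v ≈ʷ w → w ≈ʷ v} (λ where
    _ _ ih (node e p q) → node (sym e)
      (All.map (λ m → let _ , y∈Y , y≈z = find m in lose y∈Y (All.lookup ih y∈Y y≈z)) q)
      (All.tabulate (λ y∈Y → Any.map (All.lookup ih y∈Y) (All.lookup p y∈Y)))) _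

  ≈-trans : ∀ {u v w : W n} → u ≈ʷ v → v ≈ʷ w → u ≈ʷ w
  ≈-trans = W-ind {P = λ v → ∀ {u w} → u ≈ʷ v → v ≈ʷ w → u ≈ʷ w} (λ where
    _ _ ih (node e p q) (node e′ p′ q′) → node (trans e e′)
      (All.map (λ m → let _ , y∈Y , x≈y = find m
        in Any.map (All.lookup ih y∈Y x≈y) (All.lookup p′ y∈Y)) p)
      (All.map (λ m → let _ , y∈Y , y≈z = find m
        in Any.map (λ x≈y → All.lookup ih y∈Y x≈y y≈z) (All.lookup q y∈Y)) q′)) _

  ∈⇒∈ʷ : ∀ {y : W n} {Y} → y ∈ Y → y ∈ʷ Y
  ∈⇒∈ʷ y∈Y = lose y∈Y ≈-refl

  ∈ʷ-resp : ∀ {u v : W n} {Y} → u ≈ʷ v → v ∈ʷ Y → u ∈ʷ Y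
  ∈ʷ-resp u≈v = Any.map (≈-trans u≈v)

  val-cong : ∀ {v w : W n} → v ≈ʷ w → val v ≡ val w
  val-cong (node e _ _) = e

  below-cong : ∀ {u v w : W n} → v ≈ʷ w → u ∈ʷ below v → u ∈ʷ below w
  below-cong (node _ p _) m = let _ , y∈Y , u≈y = find m in ∈ʷ-resp u≈y (All.lookup p y∈Y)

  ≈-ext : ∀ {v w : W n} → val v ≡ val w →
          (∀ {u} → u ∈ʷ below v → u ∈ʷ below w) →
          (∀ {u} → u ∈ʷ below w → u ∈ʷ below v) → v ≈ʷ w
  ≈-ext {node _ _} {node _ _} e f g = node e
    (All.tabulate (f ∘ ∈⇒∈ʷ))
    (All.tabulate (Any.map ≈-sym ∘ g ∘ ∈⇒∈ʷ))

  ≤ʷ-respʳ : ∀ {u v w : W n} → v ≈ʷ w → u ≤ʷ v → u ≤ʷ w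
  ≤ʷ-respʳ v≈w (inj₁ m) = inj₁ (below-cong v≈w m)
  ≤ʷ-respʳ v≈w (inj₂ e) = inj₂ (≈-trans e v≈w)

  ≤ʷ-respˡ : ∀ {u v w : W n} → u ≈ʷ v → v ≤ʷ w → u ≤ʷ w
  ≤ʷ-respˡ u≈v (inj₁ m) = inj₁ (∈ʷ-resp u≈v m)
  ≤ʷ-respˡ u≈v (inj₂ e) = inj₂ (≈-trans u≈v e)

  mutual
    -- A point is a formal symbol with a list, so membership in a layer must not depend on the list
    -- chosen. Equal symbols have lists included in each other up to `≈ʷ`, and each clause of `New`
    -- moves along these inclusions.
    stage-resp : ∀ d {v w : W n} → v ≈ʷ w → Stage d v → Stage d w
    stage-resp (suc d) v≈w (inj₁ s)   = inj₁ (stage-resp d v≈w s)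
    stage-resp (suc d) v≈w (inj₂ new) = inj₂ (new-resp d v≈w new)

    new-resp : ∀ d {v w : W n} → v ≈ʷ w → New d v → New d w
    new-resp d {node β Y} {node .β Z} v≈w@(node refl _ _) (stages , decreasing , fresh , β⊆ , β≢) =
        all-stage-resp d (λ z∈Z → from⊆ (∈⇒∈ʷ z∈Z)) stages
      , (λ s w′∈Z u≤w′ → below-cong v≈w (decreasing s (from⊆ w′∈Z) u≤w′))
      , fresh-resp d fresh
      , (λ w′∈Z → β⊆ (from⊆ w′∈Z))
      , (λ s eq → β≢ s (λ s′ → mk⇔ (to (eq s′) ∘ below-cong v≈w) (from⊆ ∘ from (eq s′))))
      where
        from⊆ : ∀ {u} → u ∈ʷ Z → u ∈ʷ Y
        from⊆ = below-cong (≈-sym v≈w)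

        fresh-resp : ∀ d → Fresh d Y → Fresh d Z
        fresh-resp zero    _  = tt
        fresh-resp (suc d) fr = fr ∘ all-stage-resp d (λ y∈Y → below-cong v≈w (∈⇒∈ʷ y∈Y))

    all-stage-resp : ∀ d {Y Z : List (W n)} → (∀ {z} → z ∈ Z → z ∈ʷ Y) → All (Stage d) Y → All (Stage d) Z
    all-stage-resp d Z⊆Y stages = All.tabulate (λ z∈Z →
      let _ , y∈Y , z≈y = find (Z⊆Y z∈Z) in stage-resp d (≈-sym z≈y) (All.lookup stages y∈Y))

  stage-∈ : ∀ d {v : W n} {Y} → All (Stage d) Y → v ∈ʷ Y → Stage d v
  stage-∈ d stages v∈Y = let _ , y∈Y , v≈y = find v∈Y in stage-resp d (≈-sym v≈y) (All.lookup stages y∈Y)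

  new-below : ∀ d {v w : W n} → New d w → v ∈ʷ below w → Stage d v
  new-below d {w = node β Y} (stages , _) = stage-∈ d stages

  stage-below : ∀ d {v w : W n} → Stage d w → v ∈ʷ below w → Stage d v
  stage-below (suc d) (inj₁ s)   m = inj₁ (stage-below d s m)
  stage-below (suc d) (inj₂ new) m = inj₁ (new-below d new m)

  stage-≤ : ∀ d {v w : W n} → v ≤ʷ w → Stage d w → Stage d v
  stage-≤ d (inj₁ m)   s = stage-below d s m
  stage-≤ d (inj₂ v≈w) s = stage-resp d (≈-sym v≈w) s

  stage-mono : ∀ {d e} {w : W n} → d ≤ e → Stage d w → Stage e w
  stage-mono {d} {w = w} = go ∘ ℕ.≤⇒≤′
    where
      go : ∀ {e} → d ℕ.≤′ e → Stage d w → Stage e w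
      go (ℕ.≤′-reflexive refl) s = s
      go (ℕ.≤′-step d≤e)       s = inj₁ (go d≤e s)

  stage-new : ∀ d {w : W n} → Stage d w → ∃ λ e → New e w
  stage-new (suc d) (inj₁ s)   = stage-new d s
  stage-new (suc d) (inj₂ new) = d , new

  InK : W n → Set
  InK w = ∃ λ d → Stage d w

  below-InK : ∀ {v w : W n} → InK w → v ∈ʷ below w → InK v
  below-InK (d , s) m = d , stage-below d s m

  ≤-InK : ∀ {v w : W n} → InK w → v ≤ʷ w → InK v
  ≤-InK (d , s) v≤w = d , stage-≤ d v≤w s

  -- The closure clause of `New` speaks only of points of the preceding stage. Stages are closed
  -- downwards, so it reaches every `u` under a point of `below w`.
  below-trans : ∀ {u v w : W n} → InK w → u ≤ʷ v → v ∈ʷ below w → u ∈ʷ below w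
  below-trans {w = node β Y} (d , s) u≤v m with stage-new d s
  ... | e , new@(_ , decreasing , _) = decreasing (stage-≤ e u≤v (new-below e new m)) m u≤v

  ≤ʷ-trans : ∀ {u v w : W n} → InK w → u ≤ʷ v → v ≤ʷ w → u ≤ʷ w
  ≤ʷ-trans k u≤v (inj₁ m)   = inj₁ (below-trans k u≤v m)
  ≤ʷ-trans k u≤v (inj₂ v≈w) = ≤ʷ-respʳ v≈w u≤v

  -- A point new over `Stage d` that lay below itself would already belong to `Stage d`; the descent
  -- ends at the empty stage.
  below-irrefl : ∀ {w : W n} → InK w → ¬ w ∈ʷ below w
  below-irrefl {w} (d , s) = go d s
    where
      go : ∀ d → Stage d w → ¬ w ∈ʷ below w
      go (suc d) (inj₁ s)   m = go d s m
      go (suc d) (inj₂ new) m = go d (new-below d new m) m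

  below⇒≰ : ∀ {v w : W n} → InK w → v ∈ʷ below w → ¬ w ≤ʷ v
  below⇒≰ k m w≤v = below-irrefl k (below-trans k w≤v m)

  ≤∧≰⇒below : ∀ {v w : W n} → v ≤ʷ w → ¬ w ≤ʷ v → v ∈ʷ below w
  ≤∧≰⇒below (inj₁ m)   w≰v = m
  ≤∧≰⇒below (inj₂ v≈w) w≰v = contradiction (inj₂ (≈-sym v≈w)) w≰v

  val-antitone : ∀ {v w : W n} → InK w → v ≤ʷ w → val w ⊆ˢ val v
  val-antitone {w = node β Y} (d , s) (inj₁ m) with stage-new d s
  ... | _ , _ , _ , _ , β⊆ , _ = β⊆ m
  val-antitone k (inj₂ v≈w) {i} = subst (i ∈ˢ_) (sym (val-cong v≈w))

  -- Condition (iii) freed of its stage bound: the generator `w` itself belongs to `below u`, hence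
  -- to the stage over which `u` is new.
  val≢generator : ∀ {u w : W n} → InK u → (∀ {v} → v ∈ʷ below u ⇔ v ≤ʷ w) → val u ≢ val w
  val≢generator {node β Y} (d , s) eq with stage-new d s
  ... | e , new@(_ , _ , _ , _ , β≢) = β≢ (new-below e new (from eq (inj₂ ≈-refl))) (λ _ → eq)

  common-stage : ∀ {Y : List (W n)} → All InK Y → ∃ λ d → All (Stage d) Y
  common-stage []             = zero , []
  common-stage ((d , s) ∷ ks) with common-stage ks
  ... | e , ss = d ℕ.⊔ e , stage-mono (ℕ.m≤m⊔n d e) s ∷ All.map (stage-mono (ℕ.m≤n⊔m d e)) ss

-- Order automorphisms

module _ (P : Poset 0ℓ 0ℓ 0ℓ) where
  open Poset P using (Carrier; _≈_) renaming (_≤_ to _⊑_)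
  private module P = Poset P

  record OrderAut : Set where
    field
      fwd      : Carrier → Carrier
      bwd      : Carrier → Carrier
      fwd-mono : ∀ {v w} → v ⊑ w → fwd v ⊑ fwd w
      bwd-mono : ∀ {v w} → v ⊑ w → bwd v ⊑ bwd w
      fwd-bwd  : ∀ w → fwd (bwd w) ≈ w
      bwd-fwd  : ∀ w → bwd (fwd w) ≈ w

    fwd⊑⇒⊑bwd : ∀ {v w} → fwd v ⊑ w → v ⊑ bwd w
    fwd⊑⇒⊑bwd {v} p = P.trans (P.reflexive (P.Eq.sym (bwd-fwd v))) (bwd-mono p)

    ⊑bwd⇒fwd⊑ : ∀ {v w} → v ⊑ bwd w → fwd v ⊑ w
    ⊑bwd⇒fwd⊑ {w = w} p = P.trans (fwd-mono p) (P.reflexive (fwd-bwd w))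

    bwd⊑⇒⊑fwd : ∀ {v w} → bwd v ⊑ w → v ⊑ fwd w
    bwd⊑⇒⊑fwd {v} p = P.trans (P.reflexive (P.Eq.sym (fwd-bwd v))) (fwd-mono p)

    ⊑fwd⇒bwd⊑ : ∀ {v w} → v ⊑ fwd w → bwd v ⊑ w
    ⊑fwd⇒bwd⊑ {w = w} p = P.trans (bwd-mono p) (P.reflexive (bwd-fwd w))

    fwd-reflects : ∀ {v w} → fwd v ⊑ fwd w → v ⊑ w
    fwd-reflects {w = w} p = P.trans (fwd⊑⇒⊑bwd p) (P.reflexive (bwd-fwd w))

    fwd-cong : ∀ {v w} → v ≈ w → fwd v ≈ fwd w
    fwd-cong p = P.antisym (fwd-mono (P.reflexive p)) (fwd-mono (P.reflexive (P.Eq.sym p)))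

    fwd-injective : ∀ {v w} → fwd v ≈ fwd w → v ≈ w
    fwd-injective p = P.antisym (fwd-reflects (P.reflexive p)) (fwd-reflects (P.reflexive (P.Eq.sym p)))

  inverse : OrderAut → OrderAut
  inverse α = record
    { fwd = bwd ; bwd = fwd ; fwd-mono = bwd-mono ; bwd-mono = fwd-mono
    ; fwd-bwd = bwd-fwd ; bwd-fwd = fwd-bwd }
    where open OrderAut α

  -- Being strictly below is phrased by the order alone, so that order automorphisms preserve the
  -- relation.
  Covers : Carrier → Carrier → Carrier → Set
  Covers u w x = ∀ v → (v ⊑ u × ¬ u ⊑ v) ⇔ (v ⊑ w ⊎ v ⊑ x)

  Minimal : Carrier → Set
  Minimal x = ∀ {v} → v ⊑ x → x ⊑ v

  -- In K_n the covers of `x` and `x` correspond to the proper subsets of `val x`, so this property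
  -- says that `val x` is a singleton.
  UniqueCover : Carrier → Set
  UniqueCover x = ∃ λ u → Covers u x x × (∀ {u′} → Covers u′ x x → u′ ≈ u)

  -- In K_n, for x = w_{{P_i},∅}, this says that P_i ∈ val w.
  Linked : Carrier → Carrier → Set
  Linked w x = (x ⊑ w × ∃ λ u → Covers u w x)
             ⊎ (¬ x ⊑ w × ∃ λ u → ∃ λ v → ¬ u ≈ v × Covers u w x × Covers v w x)

  module _ (α : OrderAut) where
    open OrderAut α

    covers-fwd : ∀ {u w x} → Covers u w x → Covers (fwd u) (fwd w) (fwd x)
    covers-fwd cov v = mk⇔
      (λ (v⊑ , ⋢v) → Sum.map bwd⊑⇒⊑fwd bwd⊑⇒⊑fwd
        (to (cov (bwd v)) (⊑fwd⇒bwd⊑ v⊑ , ⋢v ∘ ⊑bwd⇒fwd⊑)))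
      (λ v⊑ → let p , q = from (cov (bwd v)) (Sum.map ⊑fwd⇒bwd⊑ ⊑fwd⇒bwd⊑ v⊑)
              in bwd⊑⇒⊑fwd p , q ∘ fwd⊑⇒⊑bwd)

    linked-fwd : ∀ {w x} → Linked w x → Linked (fwd w) (fwd x)
    linked-fwd (inj₁ (x⊑w , u , cov)) = inj₁ (fwd-mono x⊑w , fwd u , covers-fwd cov)
    linked-fwd (inj₂ (x⋢w , u , v , u≉v , cov , cov′)) = inj₂
      (x⋢w ∘ fwd-reflects , fwd u , fwd v , u≉v ∘ fwd-injective , covers-fwd cov , covers-fwd cov′)

    minimal-fwd : ∀ {x} → Minimal x → Minimal (fwd x)
    minimal-fwd min = ⊑bwd⇒fwd⊑ ∘ min ∘ ⊑fwd⇒bwd⊑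

  covers-resp : ∀ {u w w′ x x′} → w ≈ w′ → x ≈ x′ → Covers u w x → Covers u w′ x′
  covers-resp p q cov v = mk⇔
    (Sum.map (λ r → P.trans r (P.reflexive p)) (λ r → P.trans r (P.reflexive q)) ∘ to (cov v))
    (from (cov v) ∘ Sum.map (λ r → P.trans r (P.reflexive (P.Eq.sym p)))
                            (λ r → P.trans r (P.reflexive (P.Eq.sym q))))

  uniqueCover-fwd : ∀ (α : OrderAut) {x} → UniqueCover x → UniqueCover (OrderAut.fwd α x)
  uniqueCover-fwd α {x} (u , cov , uniq) = fwd u , covers-fwd α cov , λ {u′} cov′ →
    P.Eq.trans (P.Eq.sym (fwd-bwd u′)) (fwd-cong (uniq
      (covers-resp (bwd-fwd x) (bwd-fwd x) (covers-fwd (inverse α) cov′))))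
    where open OrderAut α

-- The action of Sym(n)

module _ {n : ℕ} where

  -- The direct image of `β`: its indicator at `i` is that of `β` at the preimage of `i`.
  image : Permutation′ n → Subset n → Subset n
  image π β = tabulate (λ i → lookup β (π ⟨$⟩ˡ i))

  ∈-image⁻ : ∀ π {i} β → i ∈ˢ image π β → (π ⟨$⟩ˡ i) ∈ˢ β
  ∈-image⁻ π {i} β i∈ = Vec.lookup⇒[]= _ β (trans (sym (Vec.lookup∘tabulate _ i)) (Vec.[]=⇒lookup i∈))

  ∈-image⁺ : ∀ π {i} β → (π ⟨$⟩ˡ i) ∈ˢ β → i ∈ˢ image π β
  ∈-image⁺ π {i} β i∈ = Vec.lookup⇒[]= i _ (trans (Vec.lookup∘tabulate _ i) (Vec.[]=⇒lookup i∈))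

  image-flip : ∀ π β → image (flip π) (image π β) ≡ β
  image-flip π β = Subset.⊆-antisym
    (λ i∈ → subst (_∈ˢ β) (inverseˡ π) (∈-image⁻ π β (∈-image⁻ (flip π) (image π β) i∈)))
    (λ i∈ → ∈-image⁺ (flip π) (image π β) (∈-image⁺ π β (subst (_∈ˢ β) (sym (inverseˡ π)) i∈)))

  image-⁅⁆ : ∀ π i → image π ⁅ i ⁆ ≡ ⁅ π ⟨$⟩ʳ i ⁆
  image-⁅⁆ π i = Subset.⊆-antisym
    (λ j∈ → subst (_∈ˢ ⁅ π ⟨$⟩ʳ i ⁆)
      (trans (cong (π ⟨$⟩ʳ_) (sym (Subset.x∈⁅y⁆⇒x≡y i (∈-image⁻ π ⁅ i ⁆ j∈)))) (inverseʳ π))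
      (Subset.x∈⁅x⁆ _))
    (λ j∈ → ∈-image⁺ π ⁅ i ⁆ (subst (_∈ˢ ⁅ i ⁆)
      (trans (sym (inverseˡ π)) (cong (π ⟨$⟩ˡ_) (sym (Subset.x∈⁅y⁆⇒x≡y _ j∈))))
      (Subset.x∈⁅x⁆ i)))

  mutual
    -- `acts` is the list map of `act`, written out so that the recursion through nested lists is
    -- structural.
    act : Permutation′ n → W n → W n
    act π (node β Y) = node (image π β) (acts π Y)

    acts : Permutation′ n → List (W n) → List (W n)
    acts π []      = []
    acts π (y ∷ Y) = act π y ∷ acts π Y

  mutual
    -- Lists are mapped entry by entry, so the two actions cancel up to `≡` and not merely up to
    -- `≈ʷ`; later transports by `subst` rest on this.
    act-flip : ∀ π w → act (flip π) (act π w) ≡ w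
    act-flip π (node β Y) = cong₂ node (image-flip π β) (acts-flip π Y)

    acts-flip : ∀ π Y → acts (flip π) (acts π Y) ≡ Y
    acts-flip π []      = refl
    acts-flip π (y ∷ Y) = cong₂ _∷_ (act-flip π y) (acts-flip π Y)

  acts-any : ∀ π {P : W n → Set} {Y} → Any (P ∘ act π) Y → Any P (acts π Y)
  acts-any π (here p)  = here p
  acts-any π (there p) = there (acts-any π p)

  acts-all : ∀ π {P : W n → Set} {Y} → All (P ∘ act π) Y → All P (acts π Y)
  acts-all π []       = []
  acts-all π (p ∷ ps) = p ∷ acts-all π ps

  act-cong : ∀ π {v w} → v ≈ʷ w → act π v ≈ʷ act π w
  act-cong π = W-ind {P = λ v → ∀ {w} → v ≈ʷ w → act π v ≈ʷ act π w} (λ where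
    _ _ ih (node e p q) → node (cong (image π) e)
      (acts-all π (All.tabulate λ y∈Y → acts-any π (Any.map (All.lookup ih y∈Y) (All.lookup p y∈Y))))
      (acts-all π (All.map (λ m → let _ , y∈Y , y≈z = find m
        in acts-any π (lose y∈Y (All.lookup ih y∈Y y≈z))) q))) _

  act-∈ : ∀ π {v Y} → v ∈ʷ Y → act π v ∈ʷ acts π Y
  act-∈ π = acts-any π ∘ Any.map (act-cong π)

  act-≤ : ∀ π {v w} → v ≤ʷ w → act π v ≤ʷ act π w
  act-≤ π {w = node _ _} (inj₁ m) = inj₁ (act-∈ π m)
  act-≤ π (inj₂ e)                = inj₂ (act-cong π e)

  act-∈⁻ : ∀ π {v Y} → v ∈ʷ acts π Y → act (flip π) v ∈ʷ Y
  act-∈⁻ π {v} {Y} m = subst (act (flip π) v ∈ʷ_) (acts-flip π Y) (act-∈ (flip π) m)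

  act-∈-flip : ∀ π {v Y} → act (flip π) v ∈ʷ Y → v ∈ʷ acts π Y
  act-∈-flip π {v} {Y} m = subst (_∈ʷ acts π Y) (act-flip (flip π) v) (act-∈ π m)

  val-act : ∀ π w → val (act π w) ≡ image π (val w)
  val-act π (node _ _) = refl

  -- Each clause of `New` for the image is checked by moving the points in question back with
  -- `flip π`, which preserves `Stage d` by the same induction.
  act-stage : ∀ d π {w} → Stage d w → Stage d (act π w)
  act-stage (suc d) π (inj₁ s) = inj₁ (act-stage d π s)
  act-stage (suc d) π {node β Y} (inj₂ (stages , decreasing , fresh , β⊆ , β≢)) = inj₂
    ( acts-all π (All.map (act-stage d π) stages)
    , (λ s w′∈ v≤w′ → act-∈-flip π (decreasing (act-stage d (flip π) s) (act-∈⁻ π w′∈) (act-≤ (flip π) v≤w′)))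
    , act-fresh d fresh
    , (λ {w′} w′∈ {i} i∈ → subst (_∈ˢ val w′) (inverseʳ π)
        (∈-image⁻ (flip π) (val w′) (subst ((π ⟨$⟩ˡ i) ∈ˢ_) (val-act (flip π) w′)
          (β⊆ (act-∈⁻ π w′∈) (∈-image⁻ π β i∈)))))
    , (λ {w′} s eq e → β≢ (act-stage d (flip π) s)
        (λ {v} s′ → mk⇔
          (λ m → subst (_≤ʷ act (flip π) w′) (act-flip π v)
            (act-≤ (flip π) (to (eq (act-stage d π s′)) (act-∈ π m))))
          (λ v≤ → subst (_∈ʷ Y) (act-flip π v) (act-∈⁻ π (from (eq (act-stage d π s′))
            (subst (act π v ≤ʷ_) (act-flip (flip π) w′) (act-≤ π v≤))))))
        (trans (sym (image-flip π β)) (trans (cong (image (flip π)) e) (sym (val-act (flip π) w′))))))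
    where
      act-fresh : ∀ d → Fresh d Y → Fresh d (acts π Y)
      act-fresh zero    _  = tt
      act-fresh (suc d) fr = λ ss → fr (subst (All (Stage d)) (acts-flip π Y)
        (acts-all (flip π) (All.map (act-stage d (flip π)) ss)))

  action : Permutation′ n → OrderAut (K n)
  action π = record
    { fwd      = λ (w , d , s) → act π w , d , act-stage d π s
    ; bwd      = λ (w , d , s) → act (flip π) w , d , act-stage d (flip π) s
    ; fwd-mono = act-≤ π
    ; bwd-mono = act-≤ (flip π)
    ; fwd-bwd  = λ (w , _) → subst (_≈ʷ w) (sym (act-flip (flip π) w)) ≈-refl
    ; bwd-fwd  = λ (w , _) → subst (_≈ʷ w) (sym (act-flip π w)) ≈-refl
    }

-- Automorphisms of Heyting algebras

module _ {c ℓ₁ ℓ₂} (A : HeytingAlgebra c ℓ₁ ℓ₂) where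
  open HeytingAlgebra A using (Carrier; _≈_; module Eq) renaming (_≤_ to _⊑_)
  private module A = HeytingAlgebra A

  module _ (φ : Automorphism A) where
    private module φ = Automorphism φ

    to-mono : ∀ {x y} → x ⊑ y → φ.to x ⊑ φ.to y
    to-mono {x} {y} x≤y = A.trans
      (A.reflexive (Eq.trans (φ.to-cong (A.antisym (A.∧-greatest A.refl x≤y) (A.x∧y≤x x y))) (φ.∧-homo x y)))
      (A.x∧y≤y _ _)

  module _ (φ : Automorphism A) where
    private module φ = Automorphism φ

    from-mono : ∀ {x y} → x ⊑ y → φ.from x ⊑ φ.from y
    from-mono = to-mono (Group._⁻¹ (Aut A) φ)

    to≤⇒≤from : ∀ {x y} → φ.to x ⊑ y → x ⊑ φ.from y
    to≤⇒≤from {x} p = A.trans (A.reflexive (Eq.sym (φ.strictlyInverseʳ x))) (from-mono p)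

    from≤⇒≤to : ∀ {x y} → φ.from x ⊑ y → x ⊑ φ.to y
    from≤⇒≤to {x} p = A.trans (A.reflexive (Eq.sym (φ.strictlyInverseˡ x))) (to-mono φ p)

    ≤from⇒to≤ : ∀ {x y} → x ⊑ φ.from y → φ.to x ⊑ y
    ≤from⇒to≤ {y = y} p = A.trans (to-mono φ p) (A.reflexive (φ.strictlyInverseˡ y))

    ≤to⇒from≤ : ∀ {x y} → x ⊑ φ.to y → φ.from x ⊑ y
    ≤to⇒from≤ {y = y} p = A.trans (from-mono p) (A.reflexive (φ.strictlyInverseʳ y))

  whole-invariant : Invariant A (whole A)
  whole-invariant φ = (λ _ → tt) , λ {b} _ → φ.from b , tt , φ.strictlyInverseˡ b
    where module φ = Automorphism φ

  module _ {s} (H : Subalgebra A s) (invariant : Invariant A H) where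
    open Subalgebra H

    restrict : Automorphism A → Automorphism algebra
    restrict φ = record
      { bijection = record
        { to        = λ (a , m) → φ.to a , proj₁ (invariant φ) m
        ; from      = λ (a , m) → φ.from a , proj₁ (invariant (Group._⁻¹ (Aut A) φ)) m
        ; to-cong   = φ.to-cong
        ; from-cong = φ.from-cong
        ; inverse   = φ.inverseˡ , φ.inverseʳ
        }
      ; ∧-homo = λ (x , _) (y , _) → φ.∧-homo x y
      ; ∨-homo = λ (x , _) (y , _) → φ.∨-homo x y
      ; ⇨-homo = λ (x , _) (y , _) → φ.⇨-homo x y
      ; ⊤-homo = φ.⊤-homo
      ; ⊥-homo = φ.⊥-homo
      }
      where module φ = Automorphism φ

-- Order automorphisms acting on decreasing subsets

module _ (P : Poset 0ℓ 0ℓ 0ℓ) (α : OrderAut P) where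
  open OrderAut α
  private module P = Poset P

  -- The direct image of `a` under `fwd`, written as the preimage under `bwd` so that membership
  -- needs no existential.
  pullback : DownSet P → DownSet P
  pullback a = record
    { member = DownSet.member a ∘ bwd ; decreasing = DownSet.decreasing a ∘ bwd-mono }

module _ (P : Poset 0ℓ 0ℓ 0ℓ) (α : OrderAut P) where
  open OrderAut α
  open DownSet
  private module P = Poset P

  lift : Automorphism (𝓞↓ P)
  lift = record
    { bijection = record
      { to        = pullback P α
      ; from      = pullback P (inverse P α)
      ; to-cong   = λ a≈b w → a≈b (bwd w)
      ; from-cong = λ a≈b w → a≈b (fwd w)
      ; inverse   =
          (λ {a} b≈ w → mk⇔ (λ p → ≈-closed a (fwd-bwd w) (to (b≈ (bwd w)) p))
                            (λ p → from (b≈ (bwd w)) (≈-closed a (P.Eq.sym (fwd-bwd w)) p)))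
        , (λ {a} b≈ w → mk⇔ (λ p → ≈-closed a (bwd-fwd w) (to (b≈ (fwd w)) p))
                            (λ p → from (b≈ (fwd w)) (≈-closed a (P.Eq.sym (bwd-fwd w)) p)))
      }
    ; ∧-homo = λ _ _ _ → mk⇔ id id
    ; ∨-homo = λ _ _ _ → mk⇔ id id
    ; ⇨-homo = λ a b w → mk⇔
        (λ f v v≤w → f (bwd v) (bwd-mono v≤w))
        -- A point `v` below `bwd w` is tested at `fwd v`, which lies below `w`.
        (λ f v v≤w p → ≈-closed b (bwd-fwd v) (f (fwd v) (⊑bwd⇒fwd⊑ v≤w) (≈-closed a (P.Eq.sym (bwd-fwd v)) p)))
    ; ⊤-homo = λ _ → mk⇔ id id
    ; ⊥-homo = λ _ → mk⇔ id id
    }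
    where
      ≈-closed : ∀ (a : DownSet P) {v w} → v P.≈ w → member a v → member a w
      ≈-closed a v≈w = decreasing a (P.reflexive (P.Eq.sym v≈w))

-- Groups

module _ {c₁ ℓ₁ c₂ ℓ₂} (G₁ : Group c₁ ℓ₁) (G₂ : Group c₂ ℓ₂) where
  private
    module G₁ = Group G₁
    module G₂ = Group G₂

  module _ (f : G₁.Carrier → G₂.Carrier)
           (f-cong : ∀ {x y} → x G₁.≈ y → f x G₂.≈ f y)
           (f-∙ : ∀ x y → f (x G₁.∙ y) G₂.≈ (f x G₂.∙ f y)) where

    ε-homo : f G₁.ε G₂.≈ G₂.ε
    ε-homo = identityˡ-unique (f G₁.ε) (f G₁.ε)
      (G₂.trans (G₂.sym (f-∙ G₁.ε G₁.ε)) (f-cong (G₁.identityˡ G₁.ε)))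
      where open GroupProperties G₂

    ⁻¹-homo : ∀ x → f (x G₁.⁻¹) G₂.≈ (f x) G₂.⁻¹
    ⁻¹-homo x = inverseˡ-unique (f (x G₁.⁻¹)) (f x)
      (G₂.trans (G₂.sym (f-∙ (x G₁.⁻¹) x)) (G₂.trans (f-cong (G₁.inverseˡ x)) ε-homo))
      where open GroupProperties G₂

    isGroupHomomorphism : IsGroupHomomorphism G₁.rawGroup G₂.rawGroup f
    isGroupHomomorphism = record
      { isMonoidHomomorphism = record
        { isMagmaHomomorphism = record
          { isRelHomomorphism = record { cong = f-cong }
          ; homo              = f-∙
          }
        ; ε-homo = ε-homo
        }
      ; ⁻¹-homo = ⁻¹-homo
      }

    range : Subgroup G₂ (c₁ ⊔ ℓ₂)
    range = record
      { member = λ y → ∃ λ x → f x G₂.≈ y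
      ; resp   = λ y≈z (x , e) → x , G₂.trans e y≈z
      ; ∙-mem  = λ (x , e) (x′ , e′) → x G₁.∙ x′ , G₂.trans (f-∙ x x′) (G₂.∙-cong e e′)
      ; ε-mem  = G₁.ε , ε-homo
      ; ⁻¹-mem = λ (x , e) → x G₁.⁻¹ , G₂.trans (⁻¹-homo x) (G₂.⁻¹-cong e)
      }

  injective⇒≅subgroup : ∀ f (f-cong : ∀ {x y} → x G₁.≈ y → f x G₂.≈ f y)
    (f-∙ : ∀ x y → f (x G₁.∙ y) G₂.≈ (f x G₂.∙ f y)) →
    (∀ {x y} → f x G₂.≈ f y → x G₁.≈ y) →
    ∃ λ (S : Subgroup G₂ (c₁ ⊔ ℓ₂)) → G₁ ≅ Subgroup.group S
  injective⇒≅subgroup f f-cong f-∙ f-injective = range f f-cong f-∙ , (λ x → f x , x , G₂.refl) , record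
    { isGroupMonomorphism = record
      { isGroupHomomorphism = record
        { isMonoidHomomorphism = record
          { isMagmaHomomorphism = record
            { isRelHomomorphism = record { cong = f-cong }
            ; homo              = f-∙
            }
          ; ε-homo = ε-homo f f-cong f-∙
          }
        ; ⁻¹-homo = ⁻¹-homo f f-cong f-∙
        }
      ; injective = f-injective
      }
    ; surjective = λ (_ , x , e) → x , λ z≈x → G₂.trans (f-cong z≈x) e
    }

  bijective⇒≅ : ∀ f (f-cong : ∀ {x y} → x G₁.≈ y → f x G₂.≈ f y)
    (f-∙ : ∀ x y → f (x G₁.∙ y) G₂.≈ (f x G₂.∙ f y)) →
    (∀ {x y} → f x G₂.≈ f y → x G₁.≈ y) → (∀ y → ∃ λ x → f x G₂.≈ y) → G₁ ≅ G₂
  bijective⇒≅ f f-cong f-∙ f-injective f-surjective = f , record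
    { isGroupMonomorphism = record
      { isGroupHomomorphism = isGroupHomomorphism f f-cong f-∙
      ; injective           = f-injective
      }
    ; surjective = λ y → let x , e = f-surjective y in x , λ z≈x → G₂.trans (f-cong z≈x) e
    }

-- Recovering the valuation from the order

module _ (em : ExcludedMiddle 0ℓ) where

  -- Supplies the freshness clause of `New`: the descent stops at stage 0 or as soon as the list no
  -- longer fits into the next smaller stage.
  least-stage : ∀ {n} {Y : List (W n)} d → All (Stage d) Y → ∃ λ e → All (Stage e) Y × Fresh e Y
  least-stage zero ss = zero , ss , tt
  least-stage {Y = Y} (suc d) ss with em {P = All (Stage d) Y}
  ... | yes ss′ = least-stage d ss′
  ... | no ¬ss′ = suc d , ss , ¬ss′

  -- Membership in K_n without layer indices. The least stage containing `Y` gives freshness, and an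
  -- equivalence known inside that stage holds everywhere because either side forces `v` into it.
  node-InK : ∀ {n} {β : Subset n} {Y} → All InK Y →
    (∀ {v w} → w ∈ʷ Y → v ≤ʷ w → v ∈ʷ Y) →
    (∀ {w} → w ∈ʷ Y → β ⊆ˢ val w) →
    (∀ {w} → InK w → (∀ {v} → v ∈ʷ Y ⇔ v ≤ʷ w) → β ≢ val w) →
    InK (node β Y)
  node-InK ks decreasing β⊆ β≢ with common-stage ks
  ... | d , ss with least-stage d ss
  ... | e , ss′ , fresh = suc e , inj₂ (ss′ , (λ _ → decreasing) , fresh , β⊆ , λ s eq →
    β≢ (e , s) (mk⇔ (λ m → to (eq (stage-∈ e ss′ m)) m)
                    (λ v≤w → from (eq (stage-≤ e v≤w s)) v≤w)))

  module _ {n : ℕ} where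
    open Poset (K n) using () renaming (Carrier to Point; _≈_ to _≈ᴷ_; _≤_ to _≤ᴷ_)

    cover-below : ∀ {u w x : Point} → Covers (K n) u w x →
                  ∀ {v} → v ∈ʷ below (proj₁ u) ⇔ (v ≤ʷ proj₁ w ⊎ v ≤ʷ proj₁ x)
    cover-below {u} {w} {x} cov {v} = mk⇔
      (λ m → to (cov (v , below-InK (proj₂ u) m)) (inj₁ m , below⇒≰ (proj₂ u) m))
      (λ p → let q , r = from (cov (v , [ ≤-InK (proj₂ w) , ≤-InK (proj₂ x) ] p)) p in ≤∧≰⇒below q r)

    cover-val : ∀ {u w x : Point} → Covers (K n) u w x →
                val (proj₁ u) ⊆ˢ val (proj₁ w) × val (proj₁ u) ⊆ˢ val (proj₁ x)
    cover-val {u} {w} {x} cov =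
        val-antitone (proj₂ u) (inj₁ (from (cover-below {u} {w} {x} cov) (inj₁ (inj₂ ≈-refl))))
      , val-antitone (proj₂ u) (inj₁ (from (cover-below {u} {w} {x} cov) (inj₂ (inj₂ ≈-refl))))

    covers-unique : ∀ {u u′ w x : Point} → Covers (K n) u w x → Covers (K n) u′ w x →
                    val (proj₁ u) ≡ val (proj₁ u′) → u ≈ᴷ u′
    covers-unique {u} {u′} {w} {x} cov cov′ e = ≈-ext e
      (from (cover-below {u′} {w} {x} cov′) ∘ to (cover-below {u} {w} {x} cov))
      (from (cover-below {u} {w} {x} cov) ∘ to (cover-below {u′} {w} {x} cov′))

    -- The witness is w_{δ,Y} with Y the union of the principal sets of `w` and `x`. The last
    -- hypothesis is condition (iii): a `v` satisfying its premises generates that union.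
    cover : ∀ (w x : Point) {δ} → δ ⊆ˢ val (proj₁ w) → δ ⊆ˢ val (proj₁ x) →
            (∀ {v} → InK v → proj₁ w ≤ʷ v → proj₁ x ≤ʷ v → v ≤ʷ proj₁ w ⊎ v ≤ʷ proj₁ x → δ ≢ val v) →
            ∃ λ (u : Point) → val (proj₁ u) ≡ δ × Covers (K n) u w x
    cover (w , kw) (x , kx) {δ} δ⊆w δ⊆x δ≢ = (node δ Y , kY) , refl , λ v → mk⇔
      (λ (p , q) → to mem (≤∧≰⇒below p q))
      (λ p → inj₁ (from mem p) , below⇒≰ kY (from mem p))
      where
        Y : List (W n)
        Y = (w ∷ below w) ++ (x ∷ below x)

        mem : ∀ {v} → v ∈ʷ Y ⇔ (v ≤ʷ w ⊎ v ≤ʷ x)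
        mem = mk⇔ (Sum.map split split ∘ Any.++⁻ (w ∷ below w))
                  [ Any.++⁺ˡ ∘ join , Any.++⁺ʳ (w ∷ below w) ∘ join ]
          where
            split : ∀ {v w} → v ∈ʷ w ∷ below w → v ≤ʷ w
            split (here e)  = inj₂ e
            split (there m) = inj₁ m

            join : ∀ {v w} → v ≤ʷ w → v ∈ʷ w ∷ below w
            join (inj₁ m) = there m
            join (inj₂ e) = here e

        inK : ∀ {v} → v ∈ʷ Y → InK v
        inK m = [ ≤-InK kw , ≤-InK kx ] (to mem m)

        kY : InK (node δ Y)
        kY = node-InK (All.tabulate (inK ∘ ∈⇒∈ʷ))
          (λ m u≤v → from mem (Sum.map (≤ʷ-trans kw u≤v) (≤ʷ-trans kx u≤v) (to mem m)))
          (λ m {i} i∈δ → [ (λ v≤w → val-antitone kw v≤w (δ⊆w i∈δ))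
                         , (λ v≤x → val-antitone kx v≤x (δ⊆x i∈δ)) ] (to mem m))
          (λ kv eq → δ≢ kv (to eq (from mem (inj₁ (inj₂ ≈-refl))))
                           (to eq (from mem (inj₂ (inj₂ ≈-refl))))
                           (to mem (from eq (inj₂ ≈-refl))))

    -- For `x = w` a generator is equivalent to `w` in the order, so condition (iii) excludes just
    -- the valuation of `w`.
    cover₁ : ∀ (w : Point) {δ} → δ ⊆ˢ val (proj₁ w) → δ ≢ val (proj₁ w) →
             ∃ λ (u : Point) → val (proj₁ u) ≡ δ × Covers (K n) u w w
    cover₁ w δ⊆w δ≢ = cover w w δ⊆w δ⊆w λ kv w≤v _ v≤w e →
      δ≢ (trans e (val-≡ kv ([ id , id ] v≤w) w≤v))
      where
        val-≡ : ∀ {v} → InK v → v ≤ʷ proj₁ w → proj₁ w ≤ʷ v → val v ≡ val (proj₁ w)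
        val-≡ kv p q = Subset.⊆-antisym (val-antitone kv q) (val-antitone (proj₂ w) p)

    cover₁-val : ∀ {u w : Point} → Covers (K n) u w w → val (proj₁ u) ≢ val (proj₁ w)
    cover₁-val {u} {w} cov = val≢generator (proj₂ u)
      (mk⇔ ([ id , id ] ∘ to (cover-below {u} {w} {w} cov)) (from (cover-below {u} {w} {w} cov) ∘ inj₁))

    ∉⇒≡∅ : ∀ {i} {β : Subset n} → β ⊆ˢ ⁅ i ⁆ → i ∉ˢ β → β ≡ ∅
    ∉⇒≡∅ {i} β⊆ i∉β = Subset.Empty-unique λ (j , j∈β) →
      i∉β (subst (_∈ˢ _) (Subset.x∈⁅y⁆⇒x≡y i (β⊆ j∈β)) j∈β)

    ⁅⁆≢∅ : ∀ {i : Fin n} → ⁅ i ⁆ ≢ ∅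
    ⁅⁆≢∅ {i} e = Subset.∉⊥ (subst (i ∈ˢ_) e (Subset.x∈⁅x⁆ i))

    -- Describes w_{{P_i},∅} up to `≈ᴷ`. The image of an atom under an order automorphism is
    -- recognised by these properties, not by its syntactic form.
    record IsAtom (i : Fin n) (x : Point) : Set where
      field
        val≡    : val (proj₁ x) ≡ ⁅ i ⁆
        minimal : Minimal (K n) x

    module _ {i : Fin n} {x : Point} (atom : IsAtom i x) where
      open IsAtom atom

      private
        ⊆val : ∀ {β} → β ⊆ˢ ⁅ i ⁆ → β ⊆ˢ val (proj₁ x)
        ⊆val β⊆ = subst (_ ∈ˢ_) (sym val≡) ∘ β⊆

        val⊆ : ∀ {β} → β ⊆ˢ val (proj₁ x) → β ⊆ˢ ⁅ i ⁆
        val⊆ β⊆ = subst (_ ∈ˢ_) val≡ ∘ β⊆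

      val⇒linked : ∀ (w : Point) → i ∈ˢ val (proj₁ w) → Linked (K n) w x
      val⇒linked w i∈w with em {P = x ≤ᴷ w}
      ... | yes x≤w = inj₁ (x≤w , proj₁ c , proj₂ (proj₂ c))
        where
          -- A generator `v` of the union lies below `w`, so its valuation contains P_i and differs
          -- from ∅.
          c = cover w x {∅} Subset.⊥⊆ Subset.⊥⊆ λ {v} kv w≤v _ v≤ e →
            Subset.∉⊥ (subst (i ∈ˢ_) (sym e)
              (val-antitone {v = v} (proj₂ w) ([ id , (λ v≤x → ≤ʷ-trans (proj₂ w) v≤x x≤w) ] v≤) i∈w))
      ... | no x≰w = inj₂ (x≰w , proj₁ c , proj₁ d
                          , (λ e → ⁅⁆≢∅ (trans (sym (proj₁ (proj₂ d))) (trans (sym (val-cong e)) (proj₁ (proj₂ c)))))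
                          , proj₂ (proj₂ c) , proj₂ (proj₂ d))
        where
          -- Neither principal set contains the other: `w` below `x` would, by minimality of `x`,
          -- put `x` below `w`. The union then has no generator, and ∅ and {P_i} give two distinct
          -- covers.
          not-generated : ∀ {v} → InK v → proj₁ w ≤ʷ v → proj₁ x ≤ʷ v → ¬ (v ≤ʷ proj₁ w ⊎ v ≤ʷ proj₁ x)
          not-generated kv _ x≤v (inj₁ v≤w) = x≰w (≤ʷ-trans (proj₂ w) x≤v v≤w)
          not-generated kv w≤v _ (inj₂ v≤x) = x≰w (minimal {w} (≤ʷ-trans (proj₂ x) w≤v v≤x))

          c = cover w x {∅} Subset.⊥⊆ Subset.⊥⊆ λ kv p q r _ → not-generated kv p q r
          d = cover w x {⁅ i ⁆} (λ j∈ → subst (_∈ˢ _) (sym (Subset.x∈⁅y⁆⇒x≡y i j∈)) i∈w) (⊆val id)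
                λ kv p q r _ → not-generated kv p q r

      -- Without P_i in `val w`, every cover of `w` and `x` has empty valuation, so there is at most
      -- one. If `x` lies below `w`, then `val w` is empty as well and condition (iii) rules out
      -- even that one.
      linked⇒val : ∀ (w : Point) → Linked (K n) w x → i ∈ˢ val (proj₁ w)
      linked⇒val w l with i Subset.∈? val (proj₁ w)
      ... | yes i∈w = i∈w
      ... | no i∉w = contradiction l not-linked
        where
          cover≡∅ : ∀ {u} → Covers (K n) u w x → val (proj₁ u) ≡ ∅
          cover≡∅ {u} cov = let u⊆w , u⊆x = cover-val {u} {w} {x} cov in ∉⇒≡∅ (val⊆ u⊆x) (i∉w ∘ u⊆w)

          not-linked : ¬ Linked (K n) w x
          not-linked (inj₁ (x≤w , u , cov)) = val≢generator (proj₂ u)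
            (mk⇔ ([ id , (λ v≤x → ≤ʷ-trans (proj₂ w) v≤x x≤w) ] ∘ to (cover-below {u} {w} {x} cov))
                 (from (cover-below {u} {w} {x} cov) ∘ inj₁))
            (trans (cover≡∅ {u} cov) (sym (∉⇒≡∅ (val⊆ (val-antitone (proj₂ w) x≤w)) i∉w)))
          not-linked (inj₂ (_ , u , v , u≉v , cov , cov′)) =
            u≉v (covers-unique {u} {v} {w} {x} cov cov′ (trans (cover≡∅ {u} cov) (sym (cover≡∅ {v} cov′))))

      atom⇒uniqueCover : UniqueCover (K n) x
      atom⇒uniqueCover = u , cov , λ {u′} cov′ →
        covers-unique {u′} {u} {x} {x} cov′ cov (trans (u′≡∅ {u′} cov′) (sym u≡∅))
        where
          c = cover₁ x {∅} Subset.⊥⊆ (λ e → ⁅⁆≢∅ (trans (sym val≡) (sym e)))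
          u = proj₁ c
          u≡∅ = proj₁ (proj₂ c)
          cov = proj₂ (proj₂ c)

          u′≡∅ : ∀ {u′} → Covers (K n) u′ x x → val (proj₁ u′) ≡ ∅
          u′≡∅ {u′} cov′ = ∉⇒≡∅ (val⊆ u′⊆x) λ i∈u′ → cover₁-val {u′} {x} cov′
            (Subset.⊆-antisym u′⊆x λ j∈x →
              subst (_∈ˢ _) (sym (Subset.x∈⁅y⁆⇒x≡y i (subst (_ ∈ˢ_) val≡ j∈x))) i∈u′)
            where u′⊆x = proj₁ (cover-val {u′} {x} {x} cov′)

    -- An empty valuation has no proper subset and so admits no cover; a valuation that strictly
    -- contains {P_i} admits the two covers with valuations ∅ and {P_i}.
    uniqueCover⇒atom : ∀ {x : Point} → Minimal (K n) x → UniqueCover (K n) x → ∃ λ i → IsAtom i x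
    uniqueCover⇒atom {x} min (u , cov , uniq) with Subset.nonempty? (val (proj₁ x))
    ... | no empty = contradiction
      (trans (Subset.Empty-unique λ (i , i∈u) → empty (i , u⊆x i∈u)) (sym (Subset.Empty-unique empty)))
      (cover₁-val {u} {x} cov)
      where u⊆x = proj₁ (cover-val {u} {x} {x} cov)
    ... | yes (i , i∈x) with em {P = val (proj₁ x) ≡ ⁅ i ⁆}
    ... | yes val≡ = i , record { val≡ = val≡ ; minimal = λ {v} → min {v} }
    ... | no val≢ = contradiction
      (trans (sym (proj₁ (proj₂ d))) (trans (val-cong d≈c) (proj₁ (proj₂ c))))
      ⁅⁆≢∅
      where
        c = cover₁ x {∅} Subset.⊥⊆ (λ e → Subset.∉⊥ (subst (i ∈ˢ_) (sym e) i∈x))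
        d = cover₁ x {⁅ i ⁆} (λ j∈ → subst (_∈ˢ _) (sym (Subset.x∈⁅y⁆⇒x≡y i j∈)) i∈x) (val≢ ∘ sym)
        d≈c : proj₁ d ≈ᴷ proj₁ c
        d≈c = ≈-trans (uniq {proj₁ d} (proj₂ (proj₂ d))) (≈-sym (uniq {proj₁ c} (proj₂ (proj₂ c))))

    atom : Fin n → Point
    -- The index is 1 because `Stage 1` is K_n^0.
    atom i = node ⁅ i ⁆ [] , 1 , inj₂ ([] , (λ _ ()) , tt , (λ ()) , (λ ()))

    atom-isAtom : ∀ i → IsAtom i (atom i)
    atom-isAtom i = record { val≡ = refl ; minimal = λ where (inj₂ e) → inj₂ (≈-sym e) }

    minimal⇒below-empty : ∀ {x : Point} → Minimal (K n) x → ∀ {v} → ¬ v ∈ʷ below (proj₁ x)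
    minimal⇒below-empty {x} min {v} m =
      below⇒≰ (proj₂ x) m (min {v , below-InK (proj₂ x) m} (inj₁ m))

    isAtom⇒≈atom : ∀ {i} {x : Point} → IsAtom i x → x ≈ᴷ atom i
    isAtom⇒≈atom {x = x} a = ≈-ext (IsAtom.val≡ a)
      (λ m → contradiction m (minimal⇒below-empty {x} λ {v} → IsAtom.minimal a {v})) (λ ())

    module _ {i : Fin n} {x y : Point} (x≈y : x ≈ᴷ y) (a : IsAtom i x) where
      open IsAtom a

      isAtom-resp : IsAtom i y
      isAtom-resp = record
        { val≡    = trans (sym (val-cong x≈y)) val≡
        ; minimal = λ {v} v≤y → ≤ʷ-respˡ (≈-sym x≈y) (minimal {v} (≤ʷ-respʳ (≈-sym x≈y) v≤y))
        }

    isAtom-injective : ∀ {i j} {x : Point} → IsAtom i x → IsAtom j x → i ≡ j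
    isAtom-injective {i} {j} a b = Subset.x∈⁅y⁆⇒x≡y j
      (subst (i ∈ˢ_) (trans (sym (IsAtom.val≡ a)) (IsAtom.val≡ b)) (Subset.x∈⁅x⁆ i))

    -- The permutation of the symbols induced by an order automorphism

    module _ (α : OrderAut (K n)) where
      open OrderAut α

      opaque
        -- The atoms are the minimal points with a unique cover, and both properties are invariant
        -- under order automorphisms.
        fwd-atom : ∀ i → ∃ λ j → IsAtom j (fwd (atom i))
        fwd-atom i = uniqueCover⇒atom {fwd (atom i)}
          (λ {v} → minimal-fwd (K n) α {atom i} (λ {w} → IsAtom.minimal (atom-isAtom i) {w}) {v})
          (uniqueCover-fwd (K n) α {atom i} (atom⇒uniqueCover (atom-isAtom i)))

      fwd-val : ∀ {i j} {x} → IsAtom i x → IsAtom j (fwd x) →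
                ∀ w → i ∈ˢ val (proj₁ w) → j ∈ˢ val (proj₁ (fwd w))
      fwd-val {x = x} a b w i∈w = linked⇒val b (fwd w) (linked-fwd (K n) α {w} {x} (val⇒linked a w i∈w))

      fwd-below : ∀ {v w} → proj₁ v ∈ʷ below (proj₁ w) → proj₁ (fwd v) ∈ʷ below (proj₁ (fwd w))
      fwd-below {v} {w} m = ≤∧≰⇒below (fwd-mono {v} {w} (inj₁ m)) (below⇒≰ (proj₂ w) m ∘ fwd-reflects {w} {v})

    perm : OrderAut (K n) → Permutation′ n
    perm α = permutation (label α) (label (inverse (K n) α)) (inverts α) (inverts (inverse (K n) α))
      where
        label : OrderAut (K n) → Fin n → Fin n
        label α i = proj₁ (fwd-atom α i)

        inverts : ∀ α i → label α (label (inverse (K n) α) i) ≡ i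
        inverts α i = isAtom-injective
          (proj₂ (fwd-atom α (label (inverse (K n) α) i)))
          (isAtom-resp {x = atom i} {fwd (atom (label (inverse (K n) α) i))}
            (≈-trans (≈-sym (fwd-bwd (atom i)))
              (fwd-cong {bwd (atom i)} {atom _} (isAtom⇒≈atom (proj₂ (fwd-atom (inverse (K n) α) i)))))
            (atom-isAtom i))
          where open OrderAut α

    perm-isAtom : ∀ α i → IsAtom (perm α ⟨$⟩ʳ i) (OrderAut.fwd α (atom i))
    perm-isAtom α i = proj₂ (fwd-atom α i)

    perm-val : ∀ α i w → i ∈ˢ val (proj₁ w) ⇔ (perm α ⟨$⟩ʳ i) ∈ˢ val (proj₁ (OrderAut.fwd α w))
    perm-val α i w = mk⇔
      (fwd-val α (atom-isAtom i) (perm-isAtom α i) w)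
      (λ j∈ → subst (i ∈ˢ_) (val-cong (bwd-fwd w))
        (fwd-val (inverse (K n) α) (perm-isAtom α i)
          (isAtom-resp {x = atom i} {bwd (fwd (atom i))} (≈-sym (bwd-fwd (atom i))) (atom-isAtom i)) (fwd w) j∈))
      where open OrderAut α

    perm-cong : ∀ α β → (∀ w → OrderAut.fwd α w ≈ᴷ OrderAut.fwd β w) → perm α ≈ₚ perm β
    perm-cong α β α≈β i = isAtom-injective
      (isAtom-resp {x = OrderAut.fwd α (atom i)} {OrderAut.fwd β (atom i)} (α≈β (atom i)) (perm-isAtom α i))
      (perm-isAtom β i)

    -- `γ` is kept separate from the composite because a product of algebra automorphisms induces
    -- the composite order automorphism only up to `≈ᴷ`.
    perm-∘ : ∀ γ α β → (∀ w → OrderAut.fwd γ w ≈ᴷ OrderAut.fwd α (OrderAut.fwd β w)) →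
             perm γ ≈ₚ (perm β ∘ₚ perm α)
    perm-∘ γ α β γ≈αβ i = isAtom-injective (perm-isAtom γ i)
      (isAtom-resp {x = OrderAut.fwd α (atom (perm β ⟨$⟩ʳ i))} {OrderAut.fwd γ (atom i)}
        (≈-trans (OrderAut.fwd-cong α {atom (perm β ⟨$⟩ʳ i)} {OrderAut.fwd β (atom i)}
                   (≈-sym (isAtom⇒≈atom (perm-isAtom β i))))
                 (≈-sym (γ≈αβ (atom i))))
        (perm-isAtom α (perm β ⟨$⟩ʳ i)))

    -- Induction on the stage: the permutation prescribes the valuation of the image of `w`, and the
    -- points below that image are the images of the points below `w`, on which both maps already
    -- agree.
    perm-injective : ∀ α β → perm α ≈ₚ perm β → ∀ w → OrderAut.fwd α w ≈ᴷ OrderAut.fwd β w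
    perm-injective α β α≈β w = go _ w (proj₂ (proj₂ w))
      where
        open OrderAut using (fwd; bwd)

        val⊆ : ∀ α β → perm α ≈ₚ perm β → ∀ w → val (proj₁ (fwd α w)) ⊆ˢ val (proj₁ (fwd β w))
        val⊆ α β α≈β w {j} j∈ = subst (_∈ˢ val (proj₁ (fwd β w)))
          (trans (sym (α≈β i)) j≡) (to (perm-val β i w) (from (perm-val α i w)
            (subst (_∈ˢ val (proj₁ (fwd α w))) (sym j≡) j∈)))
          where
            i = perm α ⟨$⟩ˡ j
            j≡ : perm α ⟨$⟩ʳ i ≡ j
            j≡ = inverseʳ (perm α)

        below⊆ : ∀ α β w → (∀ v → proj₁ v ∈ʷ below (proj₁ w) → fwd α v ≈ᴷ fwd β v) →
                 ∀ {u} → u ∈ʷ below (proj₁ (fwd α w)) → u ∈ʷ below (proj₁ (fwd β w))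
        below⊆ α β w α≈β {u} u∈ = ∈ʷ-resp
          (≈-trans (≈-sym (OrderAut.fwd-bwd α U)) (α≈β (bwd α U) v∈))
          (fwd-below β {bwd α U} {w} v∈)
          where
            U : Point
            U = u , below-InK (proj₂ (fwd α w)) u∈
            v∈ = below-cong (OrderAut.bwd-fwd α w) (fwd-below (inverse (K n) α) {U} {fwd α w} u∈)

        go : ∀ d w → Stage d (proj₁ w) → fwd α w ≈ᴷ fwd β w
        go (suc d) w (inj₁ s)   = go d w s
        go (suc d) w (inj₂ new) = ≈-ext
          (Subset.⊆-antisym (val⊆ α β α≈β w) (val⊆ β α (sym ∘ α≈β) w))
          (below⊆ α β w ih) (below⊆ β α w (λ v m → ≈-sym (ih v m)))
          where
            ih : ∀ v → proj₁ v ∈ʷ below (proj₁ w) → fwd α v ≈ᴷ fwd β v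
            ih v m = go d v (new-below d new m)

-- Density

unitFraction : (q : ℕ) .{{_ : ℕ.NonZero q}} → ℚ
unitFraction q = + 1 ℚ./ q

unitFraction-positive : ∀ q .{{_ : ℕ.NonZero q}} → 0ℚ ℚ.< unitFraction q
unitFraction-positive q = ℚ.positive⁻¹ (unitFraction q) {{ℚ.normalize-pos 1 q}}

unitFraction-antitone : ∀ p q .{{_ : ℕ.NonZero p}} .{{_ : ℕ.NonZero q}} →
                        p ≤ q → unitFraction q ℚ.≤ unitFraction p
unitFraction-antitone (suc p) (suc q) p≤q = ℚ.toℚᵘ-cancel-≤
  (ℚᵘ.≤-respˡ-≃ (ℚᵘ.≃-sym (ℚ.toℚᵘ-fromℚᵘ (mkℚᵘ (+ 1) q)))
  (ℚᵘ.≤-respʳ-≃ (ℚᵘ.≃-sym (ℚ.toℚᵘ-fromℚᵘ (mkℚᵘ (+ 1) p)))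
  (ℚᵘ.*≤* (ℤ.*-monoˡ-≤-nonNeg (+ 1) (ℤ.+≤+ p≤q)))))

-- A positive rational has numerator at least 1, so it is at least the reciprocal of its
-- denominator.
unitFraction-archimedean : ∀ ε → 0ℚ ℚ.< ε → ∀ q .{{_ : ℕ.NonZero q}} →
                           ℚ.↧ₙ ε ℕ.< q → unitFraction q ℚ.< ε
unitFraction-archimedean (mkℚ (+ zero) _ _)   (*<* (ℤ.+<+ ())) _ _
unitFraction-archimedean (mkℚ (+ suc m) d _)  _ (suc q) d<q = ℚ.toℚᵘ-cancel-<
  (ℚᵘ.<-respˡ-≃ (ℚᵘ.≃-sym (ℚ.toℚᵘ-fromℚᵘ (mkℚᵘ (+ 1) q)))
  (ℚᵘ.*<* (ℤ.+<+ (ℕ.<-≤-trans (subst (ℕ._< suc q) (sym (ℕ.*-identityˡ (suc d))) d<q)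
                              (ℕ.m≤n*m (suc q) (suc m))))))

n<2^n : ∀ n → n ℕ.< 2 ℕ.^ n
n<2^n zero    = ℕ.≤-refl
n<2^n (suc n) = ℕ.≤-trans (ℕ.+-mono-≤ (ℕ.m^n>0 2 n) (n<2^n n))
  (ℕ.≤-reflexive (cong (2 ℕ.^ n ℕ.+_) (sym (ℕ.+-identityʳ _))))

module _ {n : ℕ} where
  open DownSet

  2^-positive : ∀ i → 0ℚ ℚ.< 2^-_ n i
  2^-positive i = unitFraction-positive (2 ℕ.^ i) {{ℕ.m^n≢0 2 i}}

  2^-cancel-< : ∀ {i j} → 2^-_ n i ℚ.< 2^-_ n j → j ℕ.< i
  2^-cancel-< {i} {j} p = ℕ.≰⇒> λ i≤j → ℚ.<-irrefl refl (ℚ.<-≤-trans p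
    (unitFraction-antitone (2 ℕ.^ i) (2 ℕ.^ j) {{ℕ.m^n≢0 2 i}} {{ℕ.m^n≢0 2 j}} (ℕ.^-monoʳ-≤ 2 i≤j)))

  2^-archimedean : ∀ {ε} → 0ℚ ℚ.< ε → ∀ {i} → ℚ.↧ₙ ε ≤ i → 2^-_ n i ℚ.< ε
  2^-archimedean {ε} 0<ε {i} p =
    unitFraction-archimedean ε 0<ε (2 ℕ.^ i) {{ℕ.m^n≢0 2 i}} (ℕ.≤-<-trans p (n<2^n i))

  agreeOn-antitone : ∀ {i j a b} → i ≤ j → AgreeOn n j a b → AgreeOn n i a b
  agreeOn-antitone i≤j agr w s = agr w (stage-mono (ℕ.s≤s i≤j) s)

  -- A distance below 2^-i is either 0 or comes from a least index of disagreement beyond `i`.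
  dense⇒agreeOn : ∀ {s} (H : Subalgebra (F̂ n) s) → Dense n H →
                  ∀ a i → ∃ λ h → Subalgebra.member H h × AgreeOn n i a h
  dense⇒agreeOn H dense a i with dense a (2^-_ n i) (2^-positive i)
  ... | h , m , _ , agree agr , _      = h , m , agr i
  ... | h , m , _ , differ j _ agr , p = h , m , agr i (2^-cancel-< p)

  -- An element of `h` in a layer beyond `d` has, by induction, all its lower points in `Stage d`,
  -- which contradicts freshness for its own layer.
  bounded-by-layer : ∀ (h : DownSet (K n)) d →
    (∀ w → member h w → Stage (suc d) (proj₁ w) → Stage d (proj₁ w)) →
    ∀ w → member h w → Stage d (proj₁ w)
  bounded-by-layer h d layer w@(_ , e , s) m = go e w m s
    where
      go : ∀ e w → member h w → Stage e (proj₁ w) → Stage d (proj₁ w)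
      go (suc e) w m (inj₁ s) = go e w m s
      go (suc e) w@(node β Y , k) m (inj₂ new) with suc e ℕ.≤? suc d
      ... | yes e≤d = layer w m (stage-mono e≤d (inj₂ new))
      ... | no e≰d = contradiction new (not-new e (ℕ.≤-pred (ℕ.≰⇒> e≰d)) λ y∈Y →
            go e (_ , below-InK k (∈⇒∈ʷ y∈Y)) (decreasing h {w = w} (inj₁ (∈⇒∈ʷ y∈Y)) m)
              (new-below e new (∈⇒∈ʷ y∈Y)))
        where
          not-new : ∀ e → d ℕ.< e → (∀ {y} → y ∈ Y → Stage d y) → ¬ New e (node β Y)
          not-new (suc e) d<e stages (_ , _ , fresh , _) =
            fresh (All.tabulate (stage-mono (ℕ.≤-pred d<e) ∘ stages))

  dense⇒bounded∈ : ∀ {s} (H : Subalgebra (F̂ n) s) → Dense n H →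
    ∀ a d → (∀ w → member a w → Stage d (proj₁ w)) → Subalgebra.member H a
  -- `AgreeOn n d` compares on `Stage (suc d)`, one layer more than `a` occupies. The approximant
  -- has no point in that extra layer, hence none further up.
  dense⇒bounded∈ H dense a d bounded with dense⇒agreeOn H dense a d
  ... | h , m , agr = Subalgebra.resp H
    (λ w → mk⇔
      (λ w∈h → from (agr w (inj₁ (h-bounded w w∈h))) w∈h)
      (λ w∈a → to (agr w (inj₁ (bounded w w∈a))) w∈a))
    m
    where
      h-bounded : ∀ w → member h w → Stage d (proj₁ w)
      h-bounded = bounded-by-layer h d λ w w∈h s → bounded w (from (agr w s) w∈h)

  whole-dense : Dense n (whole (F̂ n))
  whole-dense a ε 0<ε = a , tt , 0ℚ , agree (λ _ _ _ → mk⇔ id id) , 0<ε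

-- Finiteness of the stages and density of `F̆ n`

powerlist : ∀ {a} {A : Set a} → List A → List (List A)
powerlist []       = [] ∷ []
powerlist (x ∷ xs) = powerlist xs ++ map (x ∷_) (powerlist xs)

filter∈powerlist : ∀ {a p} {A : Set a} {P : A → Set p} (P? : Decidable P) xs → filter P? xs ∈ powerlist xs
filter∈powerlist P? []       = here refl
filter∈powerlist P? (x ∷ xs) with P? x
... | yes _ = List.∈-++⁺ʳ (powerlist xs) (List.∈-map⁺ (x ∷_) (filter∈powerlist P? xs))
... | no _  = List.∈-++⁺ˡ (filter∈powerlist P? xs)

subsets : ∀ n → List (Subset n)
subsets zero    = [] ∷ []
subsets (suc n) = map (Subset.outside ∷_) (subsets n) ++ map (Subset.inside ∷_) (subsets n)

∈-subsets : ∀ {n} (β : Subset n) → β ∈ subsets n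
∈-subsets []          = here refl
∈-subsets (false ∷ β) = List.∈-++⁺ˡ (List.∈-map⁺ _ (∈-subsets β))
∈-subsets (true ∷ β)  = List.∈-++⁺ʳ (map _ (subsets _)) (List.∈-map⁺ _ (∈-subsets β))

module _ (em : ExcludedMiddle 0ℓ) {n : ℕ} where
  open Poset (K n) using () renaming (Carrier to Point; _≈_ to _≈ᴷ_; _≤_ to _≤ᴷ_)
  private module F̂ = HeytingAlgebra (F̂ n)
  open DownSet

  -- A point of the next stage is a valuation together with a subset of the current one. The list
  -- may contain symbols outside the stage; only coverage matters.
  stage-finite : ∀ d → ∃ λ L → ∀ {w : W n} → Stage d w → w ∈ʷ L
  stage-finite zero    = [] , λ ()
  stage-finite (suc d) with stage-finite d
  ... | L , covers = cartesianProductWith node (subsets n) (powerlist L) , complete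
    where
      stage-suc-below : ∀ {v w : W n} → Stage (suc d) w → v ∈ʷ below w → Stage d v
      stage-suc-below (inj₁ s)   = stage-below d s
      stage-suc-below (inj₂ new) = new-below d new

      complete : ∀ {w} → Stage (suc d) w → w ∈ʷ cartesianProductWith node (subsets n) (powerlist L)
      complete {node β Y} s = lose
        (List.∈-cartesianProductWith⁺ node (∈-subsets β) (filter∈powerlist ∈Y? L))
        (≈-ext refl
          (λ u∈Y → let _ , z∈L , u≈z = find (covers (stage-suc-below s u∈Y))
                   in lose (List.∈-filter⁺ ∈Y? z∈L (∈ʷ-resp (≈-sym u≈z) u∈Y)) u≈z)
          (λ u∈Z → let _ , z∈Z , u≈z = find u∈Z
                   in ∈ʷ-resp u≈z (proj₂ (List.∈-filter⁻ ∈Y? {xs = L} z∈Z))))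
        where
          ∈Y? : Decidable (_∈ʷ Y)
          ∈Y? _ = em

  -- The listed symbols need not be points with property `P`; excluded middle selects a
  -- representative point for each symbol that has one.
  point-cover : ∀ {P : Point → Set} (L : List (W n)) →
    ∃ λ M → All P M × (∀ w → P w → proj₁ w ∈ʷ L → Any (w ≈ᴷ_) M)
  point-cover []          = [] , [] , λ _ _ ()
  point-cover {P} (l ∷ L) with point-cover {P} L | em {P = ∃ λ p → P p × proj₁ p ≈ʷ l}
  ... | M , ps , cov | yes (p , Pp , p≈l) = p ∷ M , Pp ∷ ps , λ where
    w _  (here w≈l) → here (≈-trans w≈l (≈-sym p≈l))
    w Pw (there m)  → there (cov w Pw m)
  ... | M , ps , cov | no ∄p = M , ps , λ where
    w Pw (here w≈l) → contradiction (w , Pw , w≈l) ∄p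
    w Pw (there m)  → cov w Pw m

  join : List Point → DownSet (K n)
  join = foldr (λ w a → principal (K n) w F̂.∨ a) F̂.⊥

  join-∈ : ∀ {v} M → member (join M) v ⇔ Any (v ≤ᴷ_) M
  join-∈ []      = mk⇔ (λ ()) (λ ())
  join-∈ (w ∷ M) = mk⇔
    (λ where (inj₁ v≤w) → here v≤w
             (inj₂ m)   → there (to (join-∈ M) m))
    (λ where (here v≤w) → inj₁ v≤w
             (there m)  → inj₂ (from (join-∈ M) m))

  join∈F̆ : ∀ M → Subalgebra.member (F̆ n) (join M)
  join∈F̆ []      = ⊥-mem
  join∈F̆ (w ∷ M) = ∨-mem (gen (w , λ _ → mk⇔ id id)) (join∈F̆ M)

  -- Finitely many points of `a`, among them all those in K_n^i up to `≈ᴷ`, generate a set inside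
  -- `a` that agrees with it on K_n^i.
  truncation : ∀ a i → ∃ λ h → Subalgebra.member (F̆ n) h × AgreeOn n i a h
  truncation a i = join M , join∈F̆ M , λ w s → mk⇔
    (λ w∈a → from (join-∈ M) (Any.map inj₂ (cov w w∈a (covers s))))
    (λ w∈M → let _ , p∈M , w≤p = find (to (join-∈ M) w∈M) in decreasing a {w} w≤p (All.lookup M⊆a p∈M))
    where
      finite = stage-finite (suc i)
      covers = proj₂ finite
      chosen = point-cover {member a} (proj₁ finite)
      M      = proj₁ chosen
      M⊆a    = proj₁ (proj₂ chosen)
      cov    = proj₂ (proj₂ chosen)

  -- The metric is given by its graph, so a value has to be exhibited: excluded middle yields total
  -- agreement or a least index of disagreement.
  distance : ∀ a b i → AgreeOn n i a b → ∃ λ q → Distance n a b q × (q ≡ 0ℚ ⊎ ∃ λ j → i ℕ.< j × q ≡ 2^-_ n j)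
  distance a b i agr with em {P = ∃ λ j → ¬ AgreeOn n j a b}
  ... | no ∄j = 0ℚ , agree agr-all , inj₁ refl
    where
      agr-all : ∀ j → AgreeOn n j a b
      agr-all j with em {P = AgreeOn n j a b}
      ... | yes p = p
      ... | no ¬p = contradiction (j , ¬p) ∄j
  ... | yes (j , ¬agr) = let k , ¬agr′ , min = least j ¬agr in
    2^-_ n k , differ k ¬agr′ min
    , inj₂ (k , ℕ.≰⇒> (λ k≤i → ¬agr′ (agreeOn-antitone {a = a} {b} k≤i agr)) , refl)
    where
      least : ∀ j → ¬ AgreeOn n j a b → ∃ λ k → ¬ AgreeOn n k a b × ∀ l → l ℕ.< k → AgreeOn n l a b
      least zero    ¬agr = zero , ¬agr , λ _ ()
      least (suc j) ¬agr with em {P = AgreeOn n j a b}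
      ... | yes agr = suc j , ¬agr , λ l l<j → agreeOn-antitone {a = a} {b} (ℕ.≤-pred l<j) agr
      ... | no ¬agr′ = least j ¬agr′

  F̆-dense : Dense n (F̆ n)
  F̆-dense a ε 0<ε =
    -- The denominator d of `ε` is precise enough: 1/d is at most `ε`, and 2^d exceeds d.
    let h , m , agr = truncation a (ℚ.↧ₙ ε)
        q , dist , q-small = distance a h (ℚ.↧ₙ ε) agr
    in h , m , q , dist , q<ε q-small
    where
      q<ε : ∀ {q} → (q ≡ 0ℚ ⊎ ∃ λ j → ℚ.↧ₙ ε ℕ.< j × q ≡ 2^-_ n j) → q ℚ.< ε
      q<ε (inj₁ refl)             = 0<ε
      q<ε (inj₂ (j , i<j , refl)) = 2^-archimedean {n} 0<ε (ℕ.<⇒≤ i<j)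

-- Automorphisms of dense subalgebras

module _ (em : ExcludedMiddle 0ℓ) {n : ℕ} {s} (H : Subalgebra (F̂ n) s) (dense : Dense n H) where
  open Poset (K n) using () renaming (Carrier to Point; _≈_ to _≈ᴷ_; _≤_ to _≤ᴷ_)
  open DownSet
  open HeytingAlgebra (Subalgebra.algebra H) using (_≈_) renaming (Carrier to Elt; _≤_ to _⊑_)
  private module H = HeytingAlgebra (Subalgebra.algebra H)

  strictly-below : Point → DownSet (K n)
  strictly-below w = record
    { member     = λ v → proj₁ v ∈ʷ below (proj₁ w)
    ; decreasing = below-trans (proj₂ w)
    }

  opaque
    principal∈H : ∀ w → Subalgebra.member H (principal (K n) w)
    principal∈H (_ , d , s) = dense⇒bounded∈ H dense _ d (λ v v≤w → stage-≤ d v≤w s)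

    strictly-below∈H : ∀ w → Subalgebra.member H (strictly-below w)
    strictly-below∈H (_ , d , s) = dense⇒bounded∈ H dense _ d (λ v m → stage-below d s m)

  ↓ : Point → Elt
  ↓ w = principal (K n) w , principal∈H w

  ↓⁻ : Point → Elt
  ↓⁻ w = strictly-below w , strictly-below∈H w

  ∋⇒↓⊑ : ∀ (a : Elt) {w} → member (proj₁ a) w → ↓ w ⊑ a
  ∋⇒↓⊑ a m v v≤w = decreasing (proj₁ a) v≤w m

  ↓⊑⇒∋ : ∀ (a : Elt) {w} → ↓ w ⊑ a → member (proj₁ a) w
  ↓⊑⇒∋ a {w} p = p w (inj₂ ≈-refl)

  ↓-injective : ∀ {v w} → ↓ v ≈ ↓ w → v ≈ᴷ w
  ↓-injective {v} {w} e = Poset.antisym (K n) {v} {w} (to (e v) (inj₂ ≈-refl)) (from (e w) (inj₂ ≈-refl))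

  module _ (φ : Automorphism (Subalgebra.algebra H)) where
    private
      module φ = Automorphism φ
      B = Subalgebra.algebra H

    -- ↓ w is completely join-irreducible, ↓⁻ w being the largest element of H
    -- strictly below it; an element with this property is principal.
    to-principal : ∀ w → ∃ λ v → φ.to (↓ w) ≈ ↓ v
    to-principal w = v , H.antisym {φ.to (↓ w)} {↓ v}
      (from-split em) (∋⇒↓⊑ (φ.to (↓ w)) v∈)
      where
        to↓⋢to↓⁻ : ¬ φ.to (↓ w) ⊑ φ.to (↓⁻ w)
        to↓⋢to↓⁻ p = below-irrefl (proj₂ w) (↓w⊑↓⁻w w (inj₂ ≈-refl))
          where
            ↓w⊑↓⁻w : ↓ w ⊑ ↓⁻ w
            ↓w⊑↓⁻w = H.trans {↓ w} {φ.from (φ.to (↓⁻ w))} {↓⁻ w}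
              (to≤⇒≤from B φ {↓ w} {φ.to (↓⁻ w)} p)
              (H.reflexive {φ.from (φ.to (↓⁻ w))} {↓⁻ w} (φ.strictlyInverseʳ (↓⁻ w)))

        witness : ∃ λ v → member (proj₁ (φ.to (↓ w))) v × ¬ member (proj₁ (φ.to (↓⁻ w))) v
        witness = decidable-stable em λ ∄v → to↓⋢to↓⁻ λ v m →
          decidable-stable em λ m′ → ∄v (v , m , m′)

        v  = proj₁ witness
        v∈ = proj₁ (proj₂ witness)
        v∉ = proj₂ (proj₂ witness)

        from↓v⊑↓w : φ.from (↓ v) ⊑ ↓ w
        from↓v⊑↓w = ≤to⇒from≤ B φ {↓ v} {↓ w} (∋⇒↓⊑ (φ.to (↓ w)) v∈)

        from-split : Dec (member (proj₁ (φ.from (↓ v))) w) → φ.to (↓ w) ⊑ ↓ v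
        from-split (yes w∈) = ≤from⇒to≤ B φ {↓ w} {↓ v} (∋⇒↓⊑ (φ.from (↓ v)) w∈)
        -- If the preimage of `↓ v` missed `w`, it would lie inside `↓⁻ w`, and `v` would belong to
        -- the image of `↓⁻ w`, against its choice.
        from-split (no w∉)  = contradiction
          (↓⊑⇒∋ (φ.to (↓⁻ w)) (from≤⇒≤to B φ {↓ v} {↓⁻ w} λ u u∈ →
            ≤∧≰⇒below (from↓v⊑↓w u u∈) (w∉ ∘ λ w≤u → decreasing (proj₁ (φ.from (↓ v))) {w} {u} w≤u u∈)))
          v∉

  private
    B = Subalgebra.algebra H
    G = Aut B

  opaque
    onPoint : Automorphism B → Point → Point
    onPoint φ w = proj₁ (to-principal φ w)

    to-↓ : ∀ φ w → Automorphism.to φ (↓ w) ≈ ↓ (onPoint φ w)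
    to-↓ φ w = proj₂ (to-principal φ w)

  onPoint-≈ : ∀ φ {v w} → Automorphism.to φ (↓ v) ≈ ↓ w → onPoint φ v ≈ᴷ w
  onPoint-≈ φ {v} {w} e = ↓-injective {onPoint φ v} {w}
    (H.Eq.trans {↓ (onPoint φ v)} {Automorphism.to φ (↓ v)} {↓ w}
      (H.Eq.sym {Automorphism.to φ (↓ v)} {↓ (onPoint φ v)} (to-↓ φ v)) e)

  onPoint-mono : ∀ φ {v w} → v ≤ᴷ w → onPoint φ v ≤ᴷ onPoint φ w
  onPoint-mono φ {v} {w} v≤w = to (to-↓ φ w (onPoint φ v))
    (to-mono B φ {↓ v} {↓ w} (∋⇒↓⊑ (↓ w) {v} v≤w) (onPoint φ v) (from (to-↓ φ v (onPoint φ v)) (inj₂ ≈-refl)))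

  onPoint-∘ : ∀ φ ψ w → onPoint (Group._∙_ G φ ψ) w ≈ᴷ onPoint φ (onPoint ψ w)
  onPoint-∘ φ ψ w = onPoint-≈ (Group._∙_ G φ ψ) {w} {onPoint φ (onPoint ψ w)}
    (H.Eq.trans {φ.to (ψ.to (↓ w))} {φ.to (↓ (onPoint ψ w))} {↓ (onPoint φ (onPoint ψ w))}
      (φ.to-cong {ψ.to (↓ w)} {↓ (onPoint ψ w)} (to-↓ ψ w)) (to-↓ φ (onPoint ψ w)))
    where
      module φ = Automorphism φ
      module ψ = Automorphism ψ

  onPoint-inverse : ∀ φ ψ → (∀ x → Automorphism.to φ (Automorphism.to ψ x) ≈ x) →
                    ∀ w → onPoint φ (onPoint ψ w) ≈ᴷ w
  onPoint-inverse φ ψ inv w = ≈-trans (≈-sym (onPoint-∘ φ ψ w))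
    (onPoint-≈ (Group._∙_ G φ ψ) {w} {w} (inv (↓ w)))

  onPoints : Automorphism B → OrderAut (K n)
  onPoints φ = record
    { fwd      = onPoint φ
    ; bwd      = onPoint φ⁻¹
    ; fwd-mono = λ {v} {w} → onPoint-mono φ {v} {w}
    ; bwd-mono = λ {v} {w} → onPoint-mono φ⁻¹ {v} {w}
    ; fwd-bwd  = onPoint-inverse φ φ⁻¹ (Automorphism.strictlyInverseˡ φ)
    ; bwd-fwd  = onPoint-inverse φ⁻¹ φ (Automorphism.strictlyInverseʳ φ)
    }
    where φ⁻¹ = Group._⁻¹ G φ

  -- Membership of `w` means that `↓ w` is below `φ.to a`, that is, that the preimage of `↓ w`, the
  -- principal set of `bwd w`, is below `a`. Hence the action on points determines `φ`.
  to-member : ∀ φ (a : Elt) w → member (proj₁ (Automorphism.to φ a)) w ⇔ member (proj₁ a) (OrderAut.bwd (onPoints φ) w)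
  to-member φ a w = mk⇔
    (λ m → ≤to⇒from≤ B φ {↓ w} {a} (∋⇒↓⊑ (φ.to a) {w} m) (bwd w)
      (from (to-↓ φ⁻¹ w (bwd w)) (inj₂ ≈-refl)))
    (λ m → ↓⊑⇒∋ (φ.to a) {w} (from≤⇒≤to B φ {↓ w} {a}
      (λ v v∈ → decreasing (proj₁ a) {v} {bwd w} (to (to-↓ φ⁻¹ w v) v∈) m)))
    where
      module φ = Automorphism φ
      φ⁻¹ = Group._⁻¹ G φ
      open OrderAut (onPoints φ)

  onPoint-determines : ∀ φ ψ → (∀ w → onPoint φ w ≈ᴷ onPoint ψ w) →
                       ∀ a → Automorphism.to φ a ≈ Automorphism.to ψ a
  onPoint-determines φ ψ φ≈ψ a w = mk⇔
    (λ m → from (to-member ψ a w) (decreasing (proj₁ a) {ψ.bwd w} {φ.bwd w} (inj₂ (≈-sym bwd≈)) (to (to-member φ a w) m)))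
    (λ m → from (to-member φ a w) (decreasing (proj₁ a) {φ.bwd w} {ψ.bwd w} (inj₂ bwd≈) (to (to-member ψ a w) m)))
    where
      module φ = OrderAut (onPoints φ)
      module ψ = OrderAut (onPoints ψ)

      bwd≈ : φ.bwd w ≈ᴷ ψ.bwd w
      bwd≈ = φ.fwd-injective {φ.bwd w} {ψ.bwd w}
        (≈-trans (φ.fwd-bwd w) (≈-sym (≈-trans (φ≈ψ (ψ.bwd w)) (ψ.fwd-bwd w))))

  -- The embedding of Aut(H) into Sym(n)

  opaque
    permOf : Automorphism B → Permutation′ n
    permOf φ = perm em (onPoints φ)

    permOf-cong : ∀ {φ ψ} → Group._≈_ G φ ψ → permOf φ ≈ₚ permOf ψ
    permOf-cong {φ} {ψ} φ≈ψ = perm-cong em (onPoints φ) (onPoints ψ) λ w →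
      onPoint-≈ φ {w} {onPoint ψ w}
        (H.Eq.trans {Automorphism.to φ (↓ w)} {Automorphism.to ψ (↓ w)} {↓ (onPoint ψ w)} (φ≈ψ (↓ w)) (to-↓ ψ w))

    permOf-∘ : ∀ φ ψ → permOf (Group._∙_ G φ ψ) ≈ₚ (permOf ψ ∘ₚ permOf φ)
    permOf-∘ φ ψ = perm-∘ em (onPoints (Group._∙_ G φ ψ)) (onPoints φ) (onPoints ψ) (onPoint-∘ φ ψ)

    permOf-injective : ∀ {φ ψ} → permOf φ ≈ₚ permOf ψ → Group._≈_ G φ ψ
    permOf-injective {φ} {ψ} e = onPoint-determines φ ψ (perm-injective em (onPoints φ) (onPoints ψ) e)

  Aut≅subgroup : ∃ λ (S : Subgroup (Sym n) (lsuc 0ℓ ⊔ s)) → G ≅ Subgroup.group S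
  Aut≅subgroup = injective⇒≅subgroup G (Sym n) permOf
    (λ {φ} {ψ} → permOf-cong {φ} {ψ}) permOf-∘ (λ {φ} {ψ} → permOf-injective {φ} {ψ})

  module _ (invariant : Invariant (F̂ n) H) where

    fromPerm : Permutation′ n → Automorphism B
    fromPerm π = restrict (F̂ n) H invariant (lift (K n) (action π))

    opaque
      unfolding permOf

      -- The action of `π` turns the atom of `i` into a minimal point with valuation {P_j} for j the
      -- image of i, and an atom has only one index.
      permOf-fromPerm : ∀ π → permOf (fromPerm π) ≈ₚ π
      permOf-fromPerm π i = isAtom-injective em
        (perm-isAtom em (onPoints (fromPerm π)) i)
        (isAtom-resp em {x = act-atom} {onPoint (fromPerm π) (atom em i)}
          (≈-sym (onPoint-≈ (fromPerm π) {atom em i} {act-atom} λ w → mk⇔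
            (bwd⊑⇒⊑fwd {w} {atom em i}) (⊑fwd⇒bwd⊑ {w} {atom em i})))
          (record { val≡ = image-⁅⁆ π i
                  ; minimal = λ {v} → minimal-fwd (K n) (action π) {atom em i}
                      (λ {w} → IsAtom.minimal (atom-isAtom em i) {w}) {v} }))
        where
          open OrderAut (action π)
          act-atom : Point
          act-atom = fwd (atom em i)

    Aut≅Sym : G ≅ Sym n
    Aut≅Sym = bijective⇒≅ G (Sym n) permOf (λ {φ} {ψ} → permOf-cong {φ} {ψ}) permOf-∘
      (λ {φ} {ψ} → permOf-injective {φ} {ψ}) (λ π → fromPerm π , permOf-fromPerm π)

-- Invariance of `F̆ n` and the final statement

module _ (em : ExcludedMiddle 0ℓ) {n : ℕ} where
  private module F̂ = HeytingAlgebra (F̂ n)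

  to-F̆ : ∀ (φ : Automorphism (F̂ n)) {a} → Subalgebra.member (F̆ n) a → Subalgebra.member (F̆ n) (Automorphism.to φ a)
  to-F̆ φ = go
    where
      module φ = Automorphism φ

      go : ∀ {a} → Subalgebra.member (F̆ n) a → Subalgebra.member (F̆ n) (φ.to a)
      go (gen {a} (w , a≈↓w)) =
        -- The full algebra is itself a dense subalgebra, so its automorphisms send principal sets
        -- to principal sets.
        let v , e = to-principal em (whole (F̂ n)) whole-dense
                      (restrict (F̂ n) (whole (F̂ n)) (whole-invariant (F̂ n)) φ) w
        in gen (v , F̂.Eq.trans {φ.to a} {φ.to (principal (K n) w)} {principal (K n) v}
                      (φ.to-cong {a} {principal (K n) w} a≈↓w) e)
      go (resp {a} {b} a≈b m)    = resp (φ.to-cong {a} {b} a≈b) (go m)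
      go (∧-mem {a} {b} m m′) = resp (F̂.Eq.sym {φ.to (a F̂.∧ b)} {φ.to a F̂.∧ φ.to b} (φ.∧-homo a b)) (∧-mem (go m) (go m′))
      go (∨-mem {a} {b} m m′) = resp (F̂.Eq.sym {φ.to (a F̂.∨ b)} {φ.to a F̂.∨ φ.to b} (φ.∨-homo a b)) (∨-mem (go m) (go m′))
      go (⇨-mem {a} {b} m m′) = resp (F̂.Eq.sym {φ.to (a F̂.⇨ b)} {φ.to a F̂.⇨ φ.to b} (φ.⇨-homo a b)) (⇨-mem (go m) (go m′))
      go ⊤-mem = resp (F̂.Eq.sym {φ.to F̂.⊤} {F̂.⊤} φ.⊤-homo) ⊤-mem
      go ⊥-mem = resp (F̂.Eq.sym {φ.to F̂.⊥} {F̂.⊥} φ.⊥-homo) ⊥-mem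

  F̆-invariant : Invariant (F̂ n) (F̆ n)
  F̆-invariant φ = to-F̆ φ , λ {b} m →
    φ.from b , to-F̆ (Group._⁻¹ (Aut (F̂ n)) φ) m , φ.strictlyInverseˡ b
    where module φ = Automorphism φ

corollary6p4 : (∀ {ℓ} → ExcludedMiddle ℓ) →
    ∀ {s} (n : ℕ) → 1 ≤ n →
    (∀ (H : Subalgebra (F̂ n) s) → Dense n H →
    (∃ λ (S : Subgroup (Sym n) (lsuc 0ℓ ⊔ s)) → Aut (Subalgebra.algebra H) ≅ Subgroup.group S)
    × (Invariant (F̂ n) H → Aut (Subalgebra.algebra H) ≅ Sym n))
    × (Dense n (whole (F̂ n)) × Invariant (F̂ n) (whole (F̂ n)))
    × (Dense n (F̆ n) × Invariant (F̂ n) (F̆ n))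
corollary6p4 em n _ =
    (λ H dense → Aut≅subgroup em H dense , Aut≅Sym em H dense)
  , (whole-dense , whole-invariant (F̂ n))
  , (F̆-dense em , F̆-invariant em)
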